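{- Let $L$ be a non-trivial pseudocomplemented de Morgan algebra with dual $pm$-space $P$. Then $L\in\mathbf{M}_1$ if and only if, for every order component $Q$ of $P$, the subspace $Q\cup\zeta(Q)$ (with induced order, involution and topology) is isomorphic to one of $Q_0,Q_1,Q_2,Q_3,Q_4,Q_5$, or to $Q_6(I,S)$ for some Stone space $S$ with $|S|\ge 3$ and some set $I$ of isolated points of $S$.
   Context: $\mathbf{M}_1$ is the variety of pseudocomplemented de Morgan algebras $(L;\wedge,\vee,{}^\ast,{}^\prime,0,1)$ (bounded distributive lattice, pseudocomplement ${}^\ast$, de Morgan involution ${}^\prime$) satisfying $x\wedge x^{\prime\ast\prime}\le y\vee y^\ast$ and $(x\wedge x^{\prime\ast})^{\prime\ast}=(x\wedge x^{\prime\ast})^{\prime\ast\prime\ast}$. The dual $pm$-space is the Priestley space $(P;\tau,\le)$ of prime ideals with involution $\zeta(I)=\{a:a'\notin I\}$. An order component is a maximal subset of $P$ connected in the comparability graph of $(P;\le)$. The finite ordered sets with involution $\zeta$ (discrete topology; only the listed strict comparabilities hold): $Q_0=\{x\}$ with $\zeta(x)=x$; $Q_1=\{x,\zeta(x)\}$ incomparable; $Q_2=\{x<\zeta(x)\}$; $Q_3=\{x,y,\zeta(x),\zeta(y)\}$ with $x<\zeta(y)$, $y<\zeta(x)$; $Q_4=\{x,y,\zeta(x),\zeta(y)\}$ with $x<\zeta(y)$, $y<\zeta(y)$, $y<\zeta(x)$; $Q_5=\{x,y,\zeta(x),\zeta(y)\}$ with $x<\zeta(x)$, $x<\zeta(y)$,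 $y<\zeta(x)$, $y<\zeta(y)$. For a Stone space $S$ with $|S|\ge3$ and a set $I$ of isolated points of $S$, $Q_6(I,S)$ is $S\cup\zeta(S)$ where $\zeta(S)$ is a disjoint homeomorphic copy of $S$, with the disjoint union topology, $\zeta$ the involution interchanging $s\in S$ and its copy $\zeta(s)$, and the partial order generated by: for $x,y\in S$, $x<\zeta(y)$ iff ($x\ne y$ or $x\notin I$) (no other strict comparabilities). -}

module Defs where

open import Level using (Level; _⊔_; suc; 0ℓ)
open import Algebra.Core using (Op₁)
open import Algebra.Definitions using (Congruent₁)
open import Algebra.Lattice.Bundles using (DistributiveLattice)
import Algebra.Lattice.Properties.Lattice as LatticeProperties
open import Axiom.ExcludedMiddle using (ExcludedMiddle)
open import Data.Fin.Base using (Fin)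
open import Data.Fin.Patterns using (0F; 1F)
open import Data.List.Base using (List)
open import Data.List.Relation.Unary.Any using (Any)
open import Data.Product.Base using (Σ; ∃; _×_; _,_; proj₁; proj₂)
open import Data.Sum.Base as Sum using (_⊎_; inj₁; inj₂)
open import Data.Sum.Relation.Binary.Pointwise as Pointwise using (⊎-setoid)
open import Data.Unit.Base using (⊤)
open import Data.Unit.Polymorphic.Base using () renaming (⊤ to ⊤ₚ)
open import Function.Base using (_∘_; id)
open import Function.Bundles using (_⇔_; Inverse)
open import Relation.Binary.Bundles using (Setoid; Poset)
open import Relation.Binary.Core using (Rel)
open import Relation.Binary.Construct.Closure.ReflexiveTransitive using (Star)
open import Relation.Binary.Definitions using (Symmetric; _Respects_; _Respects₂_)
open import Relation.Binary.PropositionalEquality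
  using (_≡_; refl; resp₂; isEquivalence)
  renaming (setoid to ≡-setoid; sym to ≡-sym)
open import Relation.Nullary.Decidable using (yes; no; decidable-stable)
open import Relation.Nullary.Negation using (¬_)
open import Relation.Unary using (Pred; _∈_; _∉_; _⊆_; _≐_; _∩_; _∪_; ⋃)

------------------------------------------------------------------------
-- Zorn's lemma, for use as an explicit hypothesis

IsChain : ∀ {a ℓ₁ ℓ₂ q} (P : Poset a ℓ₁ ℓ₂) → Pred (Poset.Carrier P) q → Set (a ⊔ ℓ₂ ⊔ q)
IsChain P C = ∀ {x y} → x ∈ C → y ∈ C → x ≤ y ⊎ y ≤ x
  where open Poset P

ZornsLemma : (a ℓ₁ ℓ₂ : Level) → Set (suc (a ⊔ ℓ₁ ⊔ ℓ₂))
ZornsLemma a ℓ₁ ℓ₂ = (P : Poset a ℓ₁ ℓ₂) → let open Poset P in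
  (∀ (C : Pred Carrier a) → IsChain P C → ∃ λ u → ∀ {x} → x ∈ C → x ≤ u) →
  ∃ λ m → ∀ {x} → m ≤ x → x ≤ m

------------------------------------------------------------------------
-- Pseudocomplemented de Morgan algebras

record PMAlgebra c ℓ : Set (suc (c ⊔ ℓ)) where
  infixl 9 _* _′
  field
    distributiveLattice : DistributiveLattice c ℓ

  open DistributiveLattice distributiveLattice public
  open Poset (LatticeProperties.poset lattice) public using (_≤_)

  field
    _*               : Op₁ Carrier
    _′               : Op₁ Carrier
    0# 1#            : Carrier
    0#-minimum       : ∀ x → 0# ≤ x
    1#-maximum       : ∀ x → x ≤ 1#
    *-cong           : Congruent₁ _≈_ _*
    pseudocomplement : ∀ x y → (x ∧ y ≈ 0#) ⇔ (y ≤ x *)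
    ′-cong           : Congruent₁ _≈_ _′
    ′-involutive     : ∀ x → x ′ ′ ≈ x
    ′-∧              : ∀ x y → (x ∧ y) ′ ≈ x ′ ∨ y ′
    ′-∨              : ∀ x y → (x ∨ y) ′ ≈ x ′ ∧ y ′
    0#′              : 0# ′ ≈ 1#
    1#′              : 1# ′ ≈ 0#

NonTrivial : ∀ {c ℓ} → PMAlgebra c ℓ → Set ℓ
NonTrivial L = ¬ (0# ≈ 1#)
  where open PMAlgebra L

record M₁ {c ℓ} (L : PMAlgebra c ℓ) : Set (c ⊔ ℓ) where
  open PMAlgebra L
  field
    identity₁ : ∀ x y → x ∧ x ′ * ′ ≤ y ∨ y *
    identity₂ : ∀ x → (x ∧ x ′ *) ′ * ≈ (x ∧ x ′ *) ′ * ′ *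

------------------------------------------------------------------------
-- Topology
--
-- Subsets are predicates of a fixed level p.  In every use below p bounds
-- the levels of the carrier and of its equality, so that singletons are
-- subsets and indexing unions and covers by Set p is no restriction.

record IsTopology {s e p} (S : Setoid s e)
                  (Open : Pred (Pred (Setoid.Carrier S) p) (s ⊔ suc p)) :
                  Set (s ⊔ e ⊔ suc p) where
  open Setoid S
  field
    respects-≈ : ∀ {V} → Open V → V Respects _≈_
    respects-≐ : ∀ {V W} → V ≐ W → Open V → Open W
    whole      : Open (λ _ → ⊤ₚ)
    ∩-open     : ∀ {V W} → Open V → Open W → Open (V ∩ W)
    ⋃-open     : ∀ {J : Set p} (V : J → Pred Carrier p) →
                 (∀ j → Open (V j)) → Open (⋃ J V)

record Space s e p : Set (suc (s ⊔ e ⊔ suc p)) where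
  field
    setoid     : Setoid s e
  open Setoid setoid public
  field
    Open       : Pred (Pred Carrier p) (s ⊔ suc p)
    isTopology : IsTopology setoid Open
  open IsTopology isTopology public

-- The topology generated by a subbase.
data Generated {s p q} {A : Set s} (𝓑 : Pred (Pred A p) q) :
               Pred (Pred A p) (s ⊔ suc p ⊔ q) where
  subbasic : ∀ {V} → 𝓑 V → Generated 𝓑 V
  resp     : ∀ {V W} → V ≐ W → Generated 𝓑 V → Generated 𝓑 W
  total    : Generated 𝓑 (λ _ → ⊤ₚ)
  inter    : ∀ {V W} → Generated 𝓑 V → Generated 𝓑 W → Generated 𝓑 (V ∩ W)
  union    : ∀ {J : Set p} (V : J → Pred A p) →
             (∀ j → Generated 𝓑 (V j)) → Generated 𝓑 (⋃ J V)

discrete : (A : Set) (p : Level) → Space 0ℓ 0ℓ p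
discrete A p = record
  { setoid     = ≡-setoid A
  ; Open       = λ _ → ⊤ₚ
  ; isTopology = record { respects-≈ = λ { _ refl v → v } }
  }

module _ {s e p} (X : Space s e p) where
  open Space X

  Compact : Set (s ⊔ suc p)
  Compact = ∀ {J : Set p} (V : J → Pred Carrier p) → (∀ j → Open (V j)) →
            (∀ x → x ∈ ⋃ J V) → ∃ λ (js : List J) → ∀ x → Any (λ j → x ∈ V j) js

  Hausdorff : Set (s ⊔ e ⊔ suc p)
  Hausdorff = ∀ x y → ¬ (x ≈ y) → ∃ λ V → ∃ λ W →
              Open V × Open W × x ∈ V × y ∈ W × (∀ z → ¬ (z ∈ V × z ∈ W))

  Connected : Pred (Pred Carrier p) (s ⊔ suc p)
  Connected C = ∀ V W → Open V → Open W → C ⊆ V ∪ W →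
                ∃ (C ∩ V) → ∃ (C ∩ W) → ∃ (C ∩ (V ∩ W))

  TotallyDisconnected : Set (s ⊔ e ⊔ suc p)
  TotallyDisconnected = ∀ C → Connected C → ∀ {x y} → x ∈ C → y ∈ C → x ≈ y

  Isolated : Pred Carrier (s ⊔ e ⊔ suc p)
  Isolated x = ∃ λ V → Open V × (∀ y → y ∈ V ⇔ y ≈ x)

  HasThreePoints : Set (s ⊔ e)
  HasThreePoints = ∃ λ x → ∃ λ y → ∃ λ z → ¬ (x ≈ y) × ¬ (x ≈ z) × ¬ (y ≈ z)

record StoneSpace s e p : Set (suc (s ⊔ e ⊔ suc p)) where
  field
    space               : Space s e p
    compact             : Compact space
    hausdorff           : Hausdorff space
    totallyDisconnected : TotallyDisconnected space
  open Space space public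

record IsolatedSubset {s e p} (X : Space s e p) : Set (s ⊔ e ⊔ suc p) where
  open Space X
  field
    Member   : Pred Carrier p
    respects : Member Respects _≈_
    isolated : ∀ {x} → x ∈ Member → Isolated X x

------------------------------------------------------------------------
-- Ordered topological spaces with an order-reversing involution

record InvSpace s e o p : Set (suc (s ⊔ e ⊔ o ⊔ suc p)) where
  field
    poset        : Poset s e o
  open Poset poset public
  field
    Open         : Pred (Pred Carrier p) (s ⊔ suc p)
    isTopology   : IsTopology Eq.setoid Open
    ζ            : Carrier → Carrier
    ζ-antitone   : ∀ {x y} → x ≤ y → ζ y ≤ ζ x
    ζ-involutive : ∀ x → ζ (ζ x) ≈ x

  ζ-cong : ∀ {x y} → x ≈ y → ζ x ≈ ζ y
  ζ-cong x≈y = antisym (ζ-antitone (reflexive (Eq.sym x≈y))) (ζ-antitone (reflexive x≈y))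

infix 4 _≅_

record _≅_ {s e o s′ e′ o′ p} (X : InvSpace s e o p) (Y : InvSpace s′ e′ o′ p) :
           Set (s ⊔ e ⊔ o ⊔ s′ ⊔ e′ ⊔ o′ ⊔ suc p) where
  private
    module X = InvSpace X
    module Y = InvSpace Y
  field
    bijection : Inverse X.Eq.setoid Y.Eq.setoid
  open Inverse bijection public using (to; from)
  field
    to-order        : ∀ x y → (x X.≤ y) ⇔ (to x Y.≤ to y)
    to-ζ            : ∀ x → to (X.ζ x) Y.≈ Y.ζ (to x)
    to-continuous   : ∀ V → Y.Open V → X.Open (V ∘ to)
    from-continuous : ∀ V → X.Open V → Y.Open (V ∘ from)

module _ {s e o p} (X : InvSpace s e o p) where
  open InvSpace X

  subspace : (A : Pred Carrier p) → (∀ {x} → x ∈ A → ζ x ∈ A) → InvSpace (s ⊔ p) e o p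
  subspace A A-ζ = record
    { poset = record
      { Carrier = Σ Carrier A
      ; _≈_ = λ x y → proj₁ x ≈ proj₁ y
      ; _≤_ = λ x y → proj₁ x ≤ proj₁ y
      ; isPartialOrder = record
        { isPreorder = record
          { isEquivalence = record { refl = Eq.refl ; sym = Eq.sym ; trans = Eq.trans }
          ; reflexive = reflexive
          ; trans = trans
          }
        ; antisym = antisym
        }
      }
    ; Open = λ V → ∃ λ (W : Pred Carrier p) → Open W × V ≐ (W ∘ proj₁)
    ; isTopology = record
      { respects-≈ = λ { (W , W-open , V⊆W , W⊆V) x≈y v →
          W⊆V (respects-≈ W-open x≈y (V⊆W v)) }
      ; respects-≐ = λ { (V⊆V′ , V′⊆V) (W , W-open , V⊆W , W⊆V) →
          W , W-open , (λ v → V⊆W (V′⊆V v)) , (λ w → V⊆V′ (W⊆V w)) }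
      ; whole = _ , whole , id , id
      ; ∩-open = λ { (W , W-open , V⊆W , W⊆V) (W′ , W′-open , V′⊆W′ , W′⊆V′) →
          W ∩ W′ , ∩-open W-open W′-open
          , (λ { (v , v′) → V⊆W v , V′⊆W′ v′ })
          , (λ { (w , w′) → W⊆V w , W′⊆V′ w′ }) }
      ; ⋃-open = λ {J} V V-open →
          ⋃ J (proj₁ ∘ V-open) , ⋃-open _ (proj₁ ∘ proj₂ ∘ V-open)
          , (λ { (j , v) → j , proj₁ (proj₂ (proj₂ (V-open j))) v })
          , (λ { (j , w) → j , proj₂ (proj₂ (proj₂ (V-open j))) w })
      }
    ; ζ = λ x → ζ (proj₁ x) , A-ζ (proj₂ x)
    ; ζ-antitone = ζ-antitone
    ; ζ-involutive = λ x → ζ-involutive (proj₁ x)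
    }
    where open IsTopology isTopology

  Comparable : Rel Carrier o
  Comparable x y = x ≤ y ⊎ y ≤ x

  -- Any two points of A are joined by a path of comparabilities inside A.
  ComparabilityConnected : Pred (Pred Carrier p) (s ⊔ o ⊔ p)
  ComparabilityConnected A =
    ∀ (x y : Σ Carrier A) → Star (λ u v → Comparable (proj₁ u) (proj₁ v)) x y

  record OrderComponent : Set (s ⊔ e ⊔ o ⊔ suc p) where
    field
      Member    : Pred Carrier p
      respects  : Member Respects _≈_
      connected : ComparabilityConnected Member
      maximal   : ∀ (A : Pred Carrier p) → A Respects _≈_ → ComparabilityConnected A →
                  Member ⊆ A → A ⊆ Member

module _ {s e o} (X : InvSpace s e o (s ⊔ e)) (Q : OrderComponent X) where
  open InvSpace X
  open OrderComponent Q

  ζ-image : Pred Carrier (s ⊔ e)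
  ζ-image y = ∃ λ x → x ∈ Member × y ≈ ζ x

  -- The subspace Q ∪ ζ(Q).
  ζ-closure : InvSpace (s ⊔ e) e o (s ⊔ e)
  ζ-closure = subspace X (Member ∪ ζ-image) λ
    { (inj₁ x∈Q)             → inj₂ (_ , x∈Q , Eq.refl)
    ; (inj₂ (x , x∈Q , y≈ζx)) → inj₁
        (respects (Eq.sym (Eq.trans (ζ-cong y≈ζx) (ζ-involutive x))) x∈Q)
    }

------------------------------------------------------------------------
-- The dual pm-space

record PrimeIdeal {c ℓ} (L : PMAlgebra c ℓ) : Set (suc (c ⊔ ℓ)) where
  open PMAlgebra L
  field
    Member   : Pred Carrier (c ⊔ ℓ)
    0#-mem   : 0# ∈ Member
    ∨-mem    : ∀ {x y} → x ∈ Member → y ∈ Member → (x ∨ y) ∈ Member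
    downward : ∀ {x y} → x ≤ y → y ∈ Member → x ∈ Member
    proper   : 1# ∉ Member
    prime    : ∀ {x y} → (x ∧ y) ∈ Member → x ∈ Member ⊎ y ∈ Member

-- Excluded middle is needed for ζ(I) to be prime and for ζ(ζ(I)) = I.
module _ {c ℓ} (em : ExcludedMiddle (c ⊔ ℓ)) (L : PMAlgebra c ℓ) where
  open PMAlgebra L
  open PrimeIdeal

  private
    κ : Level
    κ = c ⊔ ℓ

    ≈⇒≤ : ∀ {x y} → x ≈ y → x ≤ y
    ≈⇒≤ = Poset.reflexive (LatticeProperties.poset lattice)

    ′-antitone : ∀ {x y} → x ≤ y → y ′ ≤ x ′
    ′-antitone {x} {y} x≤y = sym (begin
      y ′ ∧ x ′         ≈⟨ ∧-congˡ (trans (′-cong x≤y) (′-∧ x y)) ⟩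
      y ′ ∧ (x ′ ∨ y ′) ≈⟨ ∧-congˡ (∨-comm _ _) ⟩
      y ′ ∧ (y ′ ∨ x ′) ≈⟨ ∧-absorbs-∨ _ _ ⟩
      y ′               ∎)
      where open import Relation.Binary.Reasoning.Setoid setoid

    ≈-mem : ∀ (I : PrimeIdeal L) {x y} → x ≈ y → x ∈ Member I → y ∈ Member I
    ≈-mem I x≈y = downward I (≈⇒≤ (sym x≈y))

  -- ζ(I) = { a : a′ ∉ I }
  dualζ : PrimeIdeal L → PrimeIdeal L
  dualζ I = record
    { Member   = λ a → a ′ ∉ Member I
    ; 0#-mem   = λ 0′∈I → proper I (≈-mem I 0#′ 0′∈I)
    ; ∨-mem    = λ {x} {y} x∈ y∈ xy∈I →
        Sum.[ x∈ , y∈ ] (prime I (≈-mem I (′-∨ x y) xy∈I))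
    ; downward = λ x≤y y∈ x′∈I → y∈ (downward I (′-antitone x≤y) x′∈I)
    ; proper   = λ 1∈ → 1∈ (≈-mem I (sym 1#′) (0#-mem I))
    ; prime    = λ {x} {y} → split x y
    }
    where
    split : ∀ x y → (x ∧ y) ′ ∉ Member I → (x ′ ∉ Member I) ⊎ (y ′ ∉ Member I)
    split x y xy∉ with em {x ′ ∈ Member I}
    ... | no  x′∉ = inj₁ x′∉
    ... | yes x′∈ = inj₂ λ y′∈ → xy∉ (≈-mem I (sym (′-∧ x y)) (∨-mem I x′∈ y′∈))

  dualPoset : Poset (suc κ) κ κ
  dualPoset = record
    { Carrier = PrimeIdeal L
    ; _≈_ = λ I J → Member I ≐ Member J
    ; _≤_ = λ I J → Member I ⊆ Member J
    ; isPartialOrder = record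
      { isPreorder = record
        { isEquivalence = record
          { refl  = id , id
          ; sym   = λ { (f , g) → g , f }
          ; trans = λ { (f , g) (f′ , g′) → (λ a → f′ (f a)) , (λ a → g (g′ a)) }
          }
        ; reflexive = proj₁
        ; trans = λ f g a → g (f a)
        }
      ; antisym = _,_
      }
    }

  -- The sets { I : a ∉ I } and their complements, a ∈ L.
  data Subbasic (V : Pred (PrimeIdeal L) (suc κ)) : Set (suc κ) where
    omits    : ∀ a → V ≐ (λ I → a ∉ Member I) → Subbasic V
    contains : ∀ a → V ≐ (λ I → a ∈ Member I) → Subbasic V

  private
    generated-respects : ∀ {V} → Generated Subbasic V → V Respects (Poset._≈_ dualPoset)
    generated-respects (subbasic (omits a (f , g))) (_ , J⊆I) v = g λ a∈J → f v (J⊆I a∈J)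
    generated-respects (subbasic (contains a (f , g))) (I⊆J , _) v = g (I⊆J (f v))
    generated-respects (resp (f , g) V-gen) eq w = f (generated-respects V-gen eq (g w))
    generated-respects total eq v = v
    generated-respects (inter V-gen W-gen) eq (v , w) =
      generated-respects V-gen eq v , generated-respects W-gen eq w
    generated-respects (union V V-gen) eq (j , v) = j , generated-respects (V-gen j) eq v

  dualSpace : InvSpace (suc κ) κ κ (suc κ)
  dualSpace = record
    { poset = dualPoset
    ; Open = Generated Subbasic
    ; isTopology = record
      { respects-≈ = generated-respects
      ; respects-≐ = resp
      ; whole = total
      ; ∩-open = inter
      ; ⋃-open = union
      }
    ; ζ = dualζ
    ; ζ-antitone = λ I⊆J a′∉J a′∈I → a′∉J (I⊆J a′∈I)
    ; ζ-involutive = λ I →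
        (λ {a} a″∉ → decidable-stable em λ a∉I → a″∉ λ a″∈I →
          a∉I (≈-mem I (′-involutive a) a″∈I))
      , (λ {a} a∈I a″∉ → a″∉ (≈-mem I (sym (′-involutive a)) a∈I))
    }

------------------------------------------------------------------------
-- The space X ∪ ζ(X), where ζ(X) is a disjoint copy of X and the only
-- strict comparabilities are x < ζ(y) for R x y

module _ {s e p r} (X : Space s e p) (R : Rel (Space.Carrier X) r) where
  open Space X

  data DoubleOrder : Rel (Carrier ⊎ Carrier) (s ⊔ e ⊔ r) where
    lower : ∀ {x y} → x ≈ y → DoubleOrder (inj₁ x) (inj₁ y)
    upper : ∀ {x y} → x ≈ y → DoubleOrder (inj₂ x) (inj₂ y)
    cross : ∀ {x y} → R x y → DoubleOrder (inj₁ x) (inj₂ y)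

  module _ (R-sym : Symmetric R) (R-resp : R Respects₂ _≈_) where
    private
      module ⊎S = Setoid (⊎-setoid setoid setoid)

      ≤-reflexive : ∀ {u v} → u ⊎S.≈ v → DoubleOrder u v
      ≤-reflexive (Pointwise.inj₁ x≈y) = lower x≈y
      ≤-reflexive (Pointwise.inj₂ x≈y) = upper x≈y

      ≤-trans : ∀ {u v w} → DoubleOrder u v → DoubleOrder v w → DoubleOrder u w
      ≤-trans (lower a) (lower b) = lower (trans a b)
      ≤-trans (lower a) (cross b) = cross (proj₂ R-resp (sym a) b)
      ≤-trans (upper a) (upper b) = upper (trans a b)
      ≤-trans (cross a) (upper b) = cross (proj₁ R-resp b a)

      ≤-antisym : ∀ {u v} → DoubleOrder u v → DoubleOrder v u → u ⊎S.≈ v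
      ≤-antisym (lower a) (lower _) = Pointwise.inj₁ a
      ≤-antisym (upper a) (upper _) = Pointwise.inj₂ a

      swap-antitone : ∀ {u v} → DoubleOrder u v → DoubleOrder (Sum.swap v) (Sum.swap u)
      swap-antitone (lower a) = upper (sym a)
      swap-antitone (upper a) = lower (sym a)
      swap-antitone (cross a) = cross (R-sym a)

      swap-involutive : ∀ u → Sum.swap (Sum.swap u) ⊎S.≈ u
      swap-involutive (inj₁ x) = Pointwise.inj₁ (Setoid.refl setoid)
      swap-involutive (inj₂ x) = Pointwise.inj₂ (Setoid.refl setoid)

      open-respects : ∀ {V : Pred (Carrier ⊎ Carrier) p} →
                      Open (V ∘ inj₁) × Open (V ∘ inj₂) → V Respects ⊎S._≈_
      open-respects (V₁ , V₂) (Pointwise.inj₁ x≈y) v = respects-≈ V₁ x≈y v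
      open-respects (V₁ , V₂) (Pointwise.inj₂ x≈y) v = respects-≈ V₂ x≈y v

    double : InvSpace s (s ⊔ e) (s ⊔ e ⊔ r) p
    double = record
      { poset = record
        { Carrier = Carrier ⊎ Carrier
        ; _≈_ = ⊎S._≈_
        ; _≤_ = DoubleOrder
        ; isPartialOrder = record
          { isPreorder = record
            { isEquivalence = ⊎S.isEquivalence
            ; reflexive = ≤-reflexive
            ; trans = ≤-trans
            }
          ; antisym = ≤-antisym
          }
        }
      ; Open = λ V → Open (V ∘ inj₁) × Open (V ∘ inj₂)
      ; isTopology = record
        { respects-≈ = open-respects
        ; respects-≐ = λ { (f , g) (V₁ , V₂) →
            respects-≐ ((λ v → f v) , (λ w → g w)) V₁
            , respects-≐ ((λ v → f v) , (λ w → g w)) V₂ }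
        ; whole = whole , whole
        ; ∩-open = λ { (V₁ , V₂) (W₁ , W₂) → ∩-open V₁ W₁ , ∩-open V₂ W₂ }
        ; ⋃-open = λ V V-open → ⋃-open _ (proj₁ ∘ V-open) , ⋃-open _ (proj₂ ∘ V-open)
        }
      ; ζ = Sum.swap
      ; ζ-antitone = swap-antitone
      ; ζ-involutive = swap-involutive
      }

------------------------------------------------------------------------
-- The spaces Q₀, …, Q₆.  In Q₁, …, Q₅ the points x and y are 0F and 1F,
-- and a constructor ab of Rᵢ stands for a < ζ(b).

Q₀ : ∀ p → InvSpace 0ℓ 0ℓ 0ℓ p
Q₀ p = record
  { poset = record
    { Carrier = ⊤
    ; _≈_ = _≡_
    ; _≤_ = _≡_
    ; isPartialOrder = record
      { isPreorder = record
        { isEquivalence = isEquivalence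
        ; reflexive = id
        ; trans = λ { refl refl → refl }
        }
      ; antisym = λ x≡y _ → x≡y
      }
    }
  ; Open = Space.Open (discrete ⊤ p)
  ; isTopology = Space.isTopology (discrete ⊤ p)
  ; ζ = id
  ; ζ-antitone = ≡-sym
  ; ζ-involutive = λ _ → refl
  }

finiteDouble : ∀ {n} p (R : Rel (Fin n) 0ℓ) → Symmetric R → InvSpace 0ℓ 0ℓ 0ℓ p
finiteDouble {n} p R R-sym = double (discrete (Fin n) p) R R-sym (resp₂ R)

data R₁ : Rel (Fin 1) 0ℓ where

data R₂ : Rel (Fin 1) 0ℓ where
  xx : R₂ 0F 0F

data R₃ : Rel (Fin 2) 0ℓ where
  xy : R₃ 0F 1F
  yx : R₃ 1F 0F

data R₄ : Rel (Fin 2) 0ℓ where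
  xy : R₄ 0F 1F
  yy : R₄ 1F 1F
  yx : R₄ 1F 0F

data R₅ : Rel (Fin 2) 0ℓ where
  xx : R₅ 0F 0F
  xy : R₅ 0F 1F
  yx : R₅ 1F 0F
  yy : R₅ 1F 1F

Q₁ Q₂ Q₃ Q₄ Q₅ : ∀ p → InvSpace 0ℓ 0ℓ 0ℓ p
Q₁ p = finiteDouble p R₁ λ ()
Q₂ p = finiteDouble p R₂ λ { xx → xx }
Q₃ p = finiteDouble p R₃ λ { xy → yx ; yx → xy }
Q₄ p = finiteDouble p R₄ λ { xy → yx ; yy → yy ; yx → xy }
Q₅ p = finiteDouble p R₅ λ { xx → xx ; xy → yx ; yx → xy ; yy → yy }

module _ {s e p} (em : ExcludedMiddle e) (S : StoneSpace s e p)
         (I : IsolatedSubset (StoneSpace.space S)) where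
  open StoneSpace S
  open IsolatedSubset I

  R₆ : Rel Carrier (e ⊔ p)
  R₆ x y = ¬ (x ≈ y) ⊎ x ∉ Member

  private
    R₆-sym : Symmetric R₆
    R₆-sym (inj₁ x≉y) = inj₁ λ y≈x → x≉y (sym y≈x)
    R₆-sym {x} {y} (inj₂ x∉I) with em {x ≈ y}
    ... | no  x≉y = inj₁ λ y≈x → x≉y (sym y≈x)
    ... | yes x≈y = inj₂ λ y∈I → x∉I (respects (sym x≈y) y∈I)

    R₆-resp : R₆ Respects₂ _≈_
    R₆-resp =
      (λ { y≈z (inj₁ x≉y) → inj₁ λ x≈z → x≉y (trans x≈z (sym y≈z))
         ; y≈z (inj₂ x∉I) → inj₂ x∉I })
      , (λ { y≈z (inj₁ y≉x) → inj₁ λ z≈x → y≉x (trans y≈z z≈x)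
           ; y≈z (inj₂ y∉I) → inj₂ λ z∈I → y∉I (respects (sym y≈z) z∈I) })

  Q₆ : InvSpace s (s ⊔ e) (s ⊔ e ⊔ p) p
  Q₆ = double space R₆ R₆-sym R₆-resp

{-# OPTIONS --safe #-}

-- Under L ↦ P the two identities say that P has no chain of three points and that
-- x < y, x < z, y ≠ z imply ζ(y) ≤ z.  In a component with a strict comparability, write
-- s R t for s < ζ(t) on its minimal points and those of its ζ-image: the second condition
-- says that distinct R-neighbours of a point are R-adjacent, so R is a complete graph with
-- loops allowed at some vertices.  For at most two vertices this gives Q₂, …, Q₅, and
-- otherwise Q₆, where I is the set of loopless vertices: the set S of minimal points is
-- closed because ↑x ∩ ↑y differs from ζ(S) in at most two points for distinct x, y ∈ S, and
-- each x ∈ I is isolated in S because ↑x ∩ ζ(S) = ζ(S) ∖ {ζ(x)} is closed.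
-- Both the second condition and the compactness of S come from one prime separation theorem
-- for preorders on L compatible with ∧ and ∨.

module Submission where

open import Level using (Level; _⊔_; suc; 0ℓ; Lift; lift)
open import Axiom.ExcludedMiddle using (ExcludedMiddle)
open import Data.Empty using (⊥-elim)
open import Data.Fin.Base as Fin using (Fin)
open import Data.Fin.Patterns using (0F; 1F)
open import Data.List.Base as List using (List)
open import Data.List.Relation.Unary.Any using (Any; here)
open import Data.List.Relation.Unary.Any.Properties using (++⁺ˡ; ++⁺ʳ)
open import Data.Nat.Base as ℕ using ()
open import Data.Product.Base using (∃; ∃₂; _×_; _,_; proj₁; proj₂)
open import Data.Sum.Base as Sum using (_⊎_; inj₁; inj₂)
open import Data.Sum.Relation.Binary.Pointwise as Pointwise using ()
open import Function.Base using (_∘_; id; const; case_of_)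
open import Function.Bundles using (_⇔_; mk⇔; Equivalence)
open import Relation.Binary.Bundles using (Poset)
open import Relation.Binary.Core using (Rel)
open import Relation.Binary.Construct.Closure.ReflexiveTransitive
  using (Star; ε; _◅_; _◅◅_; gmap; reverse)
open import Relation.Binary.Definitions using (Symmetric; _Respects_; _Respects₂_)
import Relation.Binary.Lattice as OrderTheoretic
import Relation.Binary.Construct.NonStrictToStrict as Strict
import Algebra.Lattice.Properties.Lattice as LatticeProperties
import Relation.Binary.Properties.Poset as PosetProperties
open import Relation.Binary.PropositionalEquality using (_≡_; resp₂)
  renaming (refl to ≡-refl; sym to ≡-sym)
open import Relation.Nullary.Decidable
  using (yes; no; True; toWitness; fromWitness; decidable-stable)
open import Relation.Nullary.Negation using (¬_; contradiction)
open import Relation.Unary using (Pred; _∈_; _∉_; _⊆_; _≐_; _∩_; _∪_; ⋃; ∁)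
open import Defs

open Equivalence using () renaming (to to ⇒; from to ⇐)

-- Ordered spaces with involution

record M₁Space {s e o p} (X : InvSpace s e o p) : Set (s ⊔ e ⊔ o) where
  open InvSpace X
  open Strict _≈_ _≤_ using (_<_)
  field
    no-3-chain : ∀ {x y z} → x < y → ¬ (y < z)
    fork       : ∀ {x y z} → x < y → x < z → ¬ (y ≈ z) → ζ y ≤ z

≅-reflects-M₁Space : ∀ {s e o s′ e′ o′ p} {X : InvSpace s e o p} {Y : InvSpace s′ e′ o′ p} →
                     X ≅ Y → M₁Space Y → M₁Space X
≅-reflects-M₁Space {X = X} {Y} X≅Y Y-M₁ = record
  { no-3-chain = λ x<y y<z → no-3-chain (to-< x<y) (to-< y<z)
  ; fork = λ {x} {y} {z} x<y x<z y≉z → ⇐ (to-order (X.ζ y) z)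
      (Y.trans (Y.reflexive (to-ζ y)) (fork (to-< x<y) (to-< x<z) (y≉z ∘ to-injective)))
  }
  where
  module X = InvSpace X
  module Y = InvSpace Y
  open _≅_ X≅Y
  open M₁Space Y-M₁

  to-injective : ∀ {x y} → to x Y.≈ to y → x X.≈ y
  to-injective {x} {y} eq =
    X.antisym (⇐ (to-order x y) (Y.reflexive eq)) (⇐ (to-order y x) (Y.reflexive (Y.Eq.sym eq)))

  to-< : ∀ {x y} → x X.≤ y × ¬ x X.≈ y → to x Y.≤ to y × ¬ to x Y.≈ to y
  to-< {x} {y} (x≤y , x≉y) = ⇒ (to-order x y) x≤y , x≉y ∘ to-injective

-- Every strict comparability of a double runs from the first copy to the second, so no two of them
-- compose, and `fork` becomes the stated condition on `R`.
double-M₁Space : ∀ {s e p r} (X : Space s e p) (R : Rel (Space.Carrier X) r) →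
                 let open Space X in
                 (R-sym : Symmetric R) (R-resp : R Respects₂ _≈_) →
                 (∀ {x y z} → R x y → R x z → ¬ (y ≈ z) → R y z) →
                 M₁Space (double X R R-sym R-resp)
double-M₁Space X R R-sym R-resp R-euclidean = record
  { no-3-chain = λ
    { (lower x≈y , x≉y) _                  → x≉y (Pointwise.inj₁ x≈y)
    ; (upper x≈y , x≉y) _                  → x≉y (Pointwise.inj₂ x≈y)
    ; (cross _ , _)     (upper y≈z , y≉z) → y≉z (Pointwise.inj₂ y≈z)
    }
  ; fork = λ
    { (lower x≈y , x≉y) _ _ → contradiction (Pointwise.inj₁ x≈y) x≉y
    ; (upper x≈y , x≉y) _ _ → contradiction (Pointwise.inj₂ x≈y) x≉y
    ; (cross _ , _) (lower x≈z , x≉z) _ → contradiction (Pointwise.inj₁ x≈z) x≉z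
    ; (cross Rxy , _) (cross Rxz , _) y≉z → cross (R-euclidean Rxy Rxz (y≉z ∘ Pointwise.inj₂))
    }
  }

-- Path components and order components.

module _ {s e} (X : InvSpace s e e (s ⊔ e)) where
  open InvSpace X

  Path : Rel Carrier (s ⊔ e)
  Path = Star (Comparable X)

  path-component : Carrier → OrderComponent X
  path-component x = record
    { Member    = Path x
    ; respects  = λ y≈z p → p ◅◅ inj₁ (reflexive y≈z) ◅ ε
    ; connected = λ { (y , p) (z , q) → corestrict p (reverse Sum.swap p ◅◅ q) q }
    ; maximal   = λ A _ A-connected Path⊆A {y} y∈A →
        gmap proj₁ id (A-connected (x , Path⊆A ε) (y , y∈A))
    }
    where
    corestrict : ∀ {y z} (p : Path x y) → Path y z → (q : Path x z) →
                 Star (λ u v → Comparable X (proj₁ u) (proj₁ v)) (y , p) (z , q)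
    -- The membership proofs `p` and `q` of the endpoint may differ; a reflexive step joins them.
    corestrict p ε       q = inj₁ refl ◅ ε
    corestrict p (c ◅ r) q = c ◅ corestrict (p ◅◅ c ◅ ε) r q

  module _ (Q : OrderComponent X) where
    open OrderComponent Q

    -- The path component of a member is connected and contains the whole component, so maximality
    -- gives the converse inclusion.
    path-closed : ∀ {x y} → x ∈ Member → Path x y → y ∈ Member
    path-closed {x} x∈Q = OrderComponent.maximal Q (Path x) (Px.respects) Px.connected λ y∈Q →
      gmap proj₁ id (connected (x , x∈Q) (_ , y∈Q))
      where module Px = OrderComponent (path-component x)

    member-path : ∀ {x y} → x ∈ Member → y ∈ Member → Path x y
    member-path x∈Q y∈Q = gmap proj₁ id (connected (_ , x∈Q) (_ , y∈Q))

    -- The empty set is connected, so a member has to come from maximality: an empty component would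
    -- lie inside the path component of `x` and hence contain `x`.
    inhabited : ExcludedMiddle (s ⊔ e) → Carrier → ∃ Member
    inhabited em x with em {∃ Member}
    ... | yes y∈Q   = y∈Q
    ... | no  empty = x , maximal (Path x) Px.respects Px.connected
      (λ y∈Q → contradiction (_ , y∈Q) empty) ε
      where module Px = OrderComponent (path-component x)

  -- The points `x`, `y`, `z` of either condition lie in the path component of `x`, and the order on
  -- its `ζ`-closure is the induced one.
  components⇒M₁Space : (∀ Q → M₁Space (ζ-closure X Q)) → M₁Space X
  components⇒M₁Space good = record
    { no-3-chain = λ {x} {y} {z} x<y y<z →
        M₁Space.no-3-chain (good (path-component x))
          {x , inj₁ ε} {y , inj₁ (up x<y ◅ ε)} {z , inj₁ (up x<y ◅ up y<z ◅ ε)} x<y y<z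
    ; fork = λ {x} {y} {z} x<y x<z y≉z →
        M₁Space.fork (good (path-component x))
          {x , inj₁ ε} {y , inj₁ (up x<y ◅ ε)} {z , inj₁ (up x<z ◅ ε)} x<y x<z y≉z
    }
    where
    up : ∀ {x y} → x ≤ y × ¬ (x ≈ y) → Comparable X x y
    up = inj₁ ∘ proj₁

module InvOrder {s e o p} (X : InvSpace s e o p) where
  open InvSpace X
  open PosetProperties poset public using (_<_; <-respʳ-≈; <-respˡ-≈)

  ≈-ζζ : ∀ x → x ≈ ζ (ζ x)
  ≈-ζζ x = Eq.sym (ζ-involutive x)

  ζ-≤-reflect : ∀ {x y} → ζ x ≤ ζ y → y ≤ x
  ζ-≤-reflect {x} {y} ζx≤ζy =
    ≤-respʳ-≈ (ζ-involutive x) (≤-respˡ-≈ (ζ-involutive y) (ζ-antitone ζx≤ζy))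

  ζ-injective : ∀ {x y} → ζ x ≈ ζ y → x ≈ y
  ζ-injective ζx≈ζy =
    antisym (ζ-≤-reflect (reflexive (Eq.sym ζx≈ζy))) (ζ-≤-reflect (reflexive ζx≈ζy))

  ≤ζ-sym : ∀ {x y} → x ≤ ζ y → y ≤ ζ x
  ≤ζ-sym {y = y} x≤ζy = ≤-respˡ-≈ (ζ-involutive y) (ζ-antitone x≤ζy)

  ζ-< : ∀ {x y} → x < y → ζ y < ζ x
  ζ-< (x≤y , x≉y) = ζ-antitone x≤y , x≉y ∘ Eq.sym ∘ ζ-injective

  <ζ-sym : ∀ {x y} → x < ζ y → y < ζ x
  <ζ-sym {y = y} x<ζy = <-respˡ-≈ (ζ-involutive y) (ζ-< x<ζy)

-- Since `from` preserves and reflects the order, antisymmetry makes it congruent and injective; one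
-- inverse law then yields the other.
embedding⇒≅ : ∀ {s e o s′ e′ o′ p} {X : InvSpace s e o p} {Y : InvSpace s′ e′ o′ p} →
  let module X = InvSpace X
      module Y = InvSpace Y in
  (to : X.Carrier → Y.Carrier) (from : Y.Carrier → X.Carrier) →
  (∀ x → from (to x) X.≈ x) →
  (∀ u v → (u Y.≤ v) ⇔ (from u X.≤ from v)) →
  (∀ u → from (Y.ζ u) X.≈ X.ζ (from u)) →
  (∀ V → Y.Open V → X.Open (V ∘ to)) →
  (∀ V → X.Open V → Y.Open (V ∘ from)) →
  X ≅ Y
embedding⇒≅ {X = X} {Y} to from from∘to from-order from-ζ to-continuous from-continuous = record
  { bijection = record
    { to = to
    ; from = from
    ; to-cong = λ {x} {y} x≈y → from-injective
        (X.Eq.trans (from∘to x) (X.Eq.trans x≈y (X.Eq.sym (from∘to y))))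
    ; from-cong = from-cong
    ; inverse = (λ {u} {x} x≈from-u → from-injective (X.Eq.trans (from∘to x) x≈from-u))
              , (λ {x} u≈to-x → X.Eq.trans (from-cong u≈to-x) (from∘to x))
    }
  ; to-order = λ x y → mk⇔
      (λ x≤y → ⇐ (from-order (to x) (to y))
        (X.≤-respʳ-≈ (X.Eq.sym (from∘to y)) (X.≤-respˡ-≈ (X.Eq.sym (from∘to x)) x≤y)))
      (λ to≤ → X.≤-respʳ-≈ (from∘to y) (X.≤-respˡ-≈ (from∘to x)
        (⇒ (from-order (to x) (to y)) to≤)))
  ; to-ζ = λ x → from-injective (X.Eq.trans (from∘to (X.ζ x))
      (X.Eq.trans (X.ζ-cong (X.Eq.sym (from∘to x))) (X.Eq.sym (from-ζ (to x)))))
  ; to-continuous = to-continuous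
  ; from-continuous = from-continuous
  }
  where
  module X = InvSpace X
  module Y = InvSpace Y

  from-injective : ∀ {u v} → from u X.≈ from v → u Y.≈ v
  from-injective {u} {v} eq = Y.antisym
    (⇐ (from-order u v) (X.reflexive eq)) (⇐ (from-order v u) (X.reflexive (X.Eq.sym eq)))

  from-cong : ∀ {u v} → u Y.≈ v → from u X.≈ from v
  from-cong {u} {v} eq = X.antisym
    (⇒ (from-order u v) (Y.reflexive eq)) (⇒ (from-order v u) (Y.reflexive (Y.Eq.sym eq)))

-- Minimal points around a strict comparability.

module LowerPoints
  {s e} (em : ExcludedMiddle e) (X : InvSpace s e e (s ⊔ e)) (X-M₁ : M₁Space X)
  (Q : OrderComponent X) {x k} (x∈Q : x ∈ OrderComponent.Member Q) (x<k : InvOrder._<_ X x k)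
  where
  open InvSpace X
  open InvOrder X
  open M₁Space X-M₁
  open OrderComponent Q using (Member; respects)

  -- The set `S` seen from `x`: the point itself and its neighbours in the graph `s < ζ t`. That
  -- graph turns out to be complete, so one step from `x` reaches every vertex.
  Lower : Pred Carrier e
  Lower s = s ≈ x ⊎ x < ζ s

  Lower-resp : Lower Respects _≈_
  Lower-resp s≈t (inj₁ s≈x)   = inj₁ (Eq.trans (Eq.sym s≈t) s≈x)
  Lower-resp s≈t (inj₂ x<ζs) = inj₂ (<-respʳ-≈ (ζ-cong s≈t) x<ζs)

  -- In the absence of three-point chains, a point strictly above `s` makes `s` minimal.
  strictly-below : ∀ {s} → Lower s → ∃ λ u → s < u
  strictly-below (inj₁ s≈x)  = k , <-respˡ-≈ (Eq.sym s≈x) x<k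
  strictly-below (inj₂ x<ζs) = ζ x , <ζ-sym x<ζs

  -- Completeness of the graph: for two neighbours of `x` it is `fork` at `x`, whose conclusion
  -- reads `ζ (ζ s) ≤ ζ t`.
  Lower-adjacent : ∀ {s t} → Lower s → Lower t → ¬ (s ≈ t) → s ≤ ζ t
  Lower-adjacent (inj₁ s≈x) (inj₁ t≈x) s≉t = contradiction (Eq.trans s≈x (Eq.sym t≈x)) s≉t
  Lower-adjacent (inj₁ s≈x) (inj₂ x<ζt) _ = ≤-respˡ-≈ (Eq.sym s≈x) (proj₁ x<ζt)
  Lower-adjacent (inj₂ x<ζs) (inj₁ t≈x) _ =
    ≤-respʳ-≈ (ζ-cong (Eq.sym t≈x)) (proj₁ (<ζ-sym x<ζs))
  Lower-adjacent {s} (inj₂ x<ζs) (inj₂ x<ζt) s≉t =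
    ≤-respˡ-≈ (ζ-involutive s) (fork x<ζs x<ζt (s≉t ∘ ζ-injective))

  Lower-closed : ∀ {s t} → Lower s → s < ζ t → Lower t
  Lower-closed (inj₁ s≈x) s<ζt = inj₂ (<-respˡ-≈ s≈x s<ζt)
  Lower-closed {s} {t} (inj₂ x<ζs) s<ζt with em {t ≈ x}
  ... | yes t≈x = inj₁ t≈x
  -- Both `ζ x` and `ζ t` lie strictly above `s`, so `fork` at `s` gives `x ≤ ζ t`; equality would
  -- produce the chain `s < ζ t < k`.
  ... | no  t≉x = inj₂
    ( ≤-respˡ-≈ (ζ-involutive x) (fork (<ζ-sym x<ζs) s<ζt (t≉x ∘ Eq.sym ∘ ζ-injective))
    , λ x≈ζt → no-3-chain s<ζt (<-respˡ-≈ x≈ζt x<k) )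

  Lower-antichain : ∀ {s t} → Lower t → s ≤ t → s ≈ t
  Lower-antichain {s} {t} t∈S s≤t with em {s ≈ t}
  ... | yes s≈t = s≈t
  ... | no  s≉t = contradiction (proj₂ (strictly-below t∈S)) (no-3-chain (s≤t , s≉t))

  -- Minimality of `t` would force `ζ s ≈ t`, but `ζ s` has a point strictly below it and `t` has
  -- one strictly above it.
  Lower-disjoint : ∀ {s t} → Lower s → Lower t → ¬ (ζ s ≤ t)
  Lower-disjoint s∈S t∈S ζs≤t = no-3-chain
    (ζ-< (proj₂ (strictly-below s∈S)))
    (<-respˡ-≈ (Eq.sym (Lower-antichain t∈S ζs≤t)) (proj₂ (strictly-below t∈S)))

  Lower⊆closure : ∀ {s} → Lower s → s ∈ Member ⊎ s ∈ ζ-image X Q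
  Lower⊆closure (inj₁ s≈x) = inj₁ (respects (Eq.sym s≈x) x∈Q)
  Lower⊆closure {s} (inj₂ x<ζs) =
    inj₂ (ζ s , path-closed X Q x∈Q (inj₁ (proj₁ x<ζs) ◅ ε) , ≈-ζζ s)

  Covered : Pred Carrier e
  Covered y = Lower y ⊎ Lower (ζ y)

  Covered-resp : Covered Respects _≈_
  Covered-resp y≈z = Sum.map (Lower-resp y≈z) (Lower-resp (ζ-cong y≈z))

  Covered-ζ : ∀ {y} → Covered y → Covered (ζ y)
  Covered-ζ {y} = Sum.swap ∘ Sum.map₁ (Lower-resp (≈-ζζ y))

  -- Going down from a minimal point leads nowhere new; going strictly up from `u` to `v ≈ ζ (ζ v)`
  -- makes `ζ v` a neighbour of `u`.
  Covered-step : ∀ {u v} → Lower u → Comparable X u v → Covered v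
  Covered-step {u} {v} u∈S (inj₁ u≤v) with em {u ≈ v}
  ... | yes u≈v = inj₁ (Lower-resp u≈v u∈S)
  ... | no  u≉v = inj₂ (Lower-closed u∈S (<-respʳ-≈ (≈-ζζ v) (u≤v , u≉v)))
  Covered-step u∈S (inj₂ v≤u) = inj₁ (Lower-resp (Eq.sym (Lower-antichain u∈S v≤u)) u∈S)

  Covered-path : ∀ {u v} → Covered u → Path X u v → Covered v
  Covered-path u∈ ε = u∈
  Covered-path (inj₁ u∈S)  (c ◅ p) = Covered-path (Covered-step u∈S c) p
  Covered-path (inj₂ ζu∈S) (_◅_ {j = w} c p) =
    Covered-path (Covered-resp (ζ-involutive w)
      (Covered-ζ (Covered-step ζu∈S (Sum.swap (Sum.map ζ-antitone ζ-antitone c))))) p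

  closure⊆Covered : ∀ {y} → y ∈ Member ⊎ y ∈ ζ-image X Q → Covered y
  closure⊆Covered (inj₁ y∈Q) = Covered-path (inj₁ (inj₁ Eq.refl)) (member-path X Q x∈Q y∈Q)
  closure⊆Covered (inj₂ (z , z∈Q , y≈ζz)) =
    Covered-resp (Eq.sym y≈ζz) (Covered-ζ (closure⊆Covered (inj₁ z∈Q)))

  module _ {y} (y∈S : Lower y) (y≉x : ¬ (y ≈ x)) where

    -- A description of the lower points by the closed sets ↑x, ↑y, {x} and {y}.
    Lower⇒closed : ∀ {s} → Lower s → (x ≤ ζ s × y ≤ ζ s) ⊎ s ≈ x ⊎ s ≈ y
    Lower⇒closed {s} s∈S with em {s ≈ x} | em {s ≈ y}
    ... | yes s≈x | _       = inj₂ (inj₁ s≈x)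
    ... | no  _   | yes s≈y = inj₂ (inj₂ s≈y)
    ... | no  s≉x | no  s≉y = inj₁
      ( Lower-adjacent (inj₁ Eq.refl) s∈S (s≉x ∘ Eq.sym)
      , Lower-adjacent y∈S s∈S (s≉y ∘ Eq.sym) )

    -- The condition `x ≤ ζ s` alone admits `s ≈ ζ x`; in that case `y ≤ ζ s` would put `y` below
    -- the minimal point `x`.
    closed⇒Lower : ∀ {s} → (x ≤ ζ s × y ≤ ζ s) ⊎ s ≈ x ⊎ s ≈ y → Lower s
    closed⇒Lower {s} (inj₁ (x≤ζs , y≤ζs)) with em {x ≈ ζ s}
    ... | no  x≉ζs = inj₂ (x≤ζs , x≉ζs)
    ... | yes x≈ζs = contradiction
      (Lower-antichain (inj₁ Eq.refl) (≤-respʳ-≈ (Eq.sym x≈ζs) y≤ζs)) y≉x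
    closed⇒Lower (inj₂ (inj₁ s≈x)) = inj₁ s≈x
    closed⇒Lower (inj₂ (inj₂ s≈y)) = Lower-resp (Eq.sym s≈y) y∈S

module PrimeIdeals
  (em : ∀ {a} → ExcludedMiddle a)
  (zorn : ∀ {a ℓ₁ ℓ₂} → ZornsLemma a ℓ₁ ℓ₂)
  {c ℓ} (L : PMAlgebra c ℓ)
  where

  open PMAlgebra L hiding (reflexive)
  open PrimeIdeal
  open OrderTheoretic.Lattice (LatticeProperties.∨-∧-orderTheoreticLattice lattice)
    using (x≤x∨y; y≤x∨y; ∨-least; x∧y≤x; x∧y≤y; ∧-greatest; reflexive; antisym)
    renaming (refl to ≤-refl; trans to ≤-trans)

  private
    κ : Level
    κ = c ⊔ ℓ

  P : InvSpace (suc κ) κ κ (suc κ)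
  P = dualSpace em L

  private
    module P = InvSpace P
  open P using (ζ) renaming (_≤_ to _⊑_; _≈_ to _≋_)
  open Strict _≋_ _⊑_ using () renaming (_<_ to _⊏_)

  by-contradiction : ∀ {a} {A : Set a} → ¬ ¬ A → A
  by-contradiction = decidable-stable em

  -- Excluded middle makes predicates of any level equivalent to ones of level κ.
  Resize : ∀ {p} → Set p → Set κ
  Resize A = Lift κ (True (em {P = A}))

  resize : ∀ {p} {A : Set p} → A → Resize A
  resize x = lift (fromWitness x)

  unresize : ∀ {p} {A : Set p} → Resize A → A
  unresize (lift x) = toWitness x

  -- Prime separation

  -- Such a preorder is the order of a lattice quotient of `L`, pulled back to `L`; its down-closed
  -- prime ideals are those of the quotient.
  record CompatiblePreorder {r} (_≼_ : Rel Carrier r) : Set (c ⊔ ℓ ⊔ r) where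
    field
      ≤⇒≼          : ∀ {x y} → x ≤ y → x ≼ y
      ≼-trans      : ∀ {x y z} → x ≼ y → y ≼ z → x ≼ z
      ≼-∧-greatest : ∀ {x y z} → x ≼ y → x ≼ z → x ≼ (y ∧ z)
      ≼-∨-least    : ∀ {x y z} → x ≼ z → y ≼ z → (x ∨ y) ≼ z

  ≤-compatible : CompatiblePreorder _≤_
  ≤-compatible = record
    { ≤⇒≼ = id ; ≼-trans = ≤-trans ; ≼-∧-greatest = ∧-greatest ; ≼-∨-least = ∨-least }

  module _ {r} {_≼_ : Rel Carrier r} (≼-compatible : CompatiblePreorder _≼_) where
    open CompatiblePreorder ≼-compatible

    ≼-∨-mono : ∀ {w x y z} → w ≼ x → y ≼ z → (w ∨ y) ≼ (x ∨ z)
    ≼-∨-mono w≼x y≼z =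
      ≼-∨-least (≼-trans w≼x (≤⇒≼ (x≤x∨y _ _))) (≼-trans y≼z (≤⇒≼ (y≤x∨y _ _)))

    ≼-∨-∧-least : ∀ {w x y i j} → w ≼ (i ∨ x) → w ≼ (j ∨ y) → w ≼ ((i ∨ j) ∨ (x ∧ y))
    ≼-∨-∧-least {w} {x} {y} {i} {j} w≼ix w≼jy = ≼-trans
      (≼-∧-greatest
        (≼-trans w≼ix (≼-∨-mono (≤⇒≼ (x≤x∨y i j)) (≤⇒≼ ≤-refl)))
        (≼-trans w≼jy (≼-∨-mono (≤⇒≼ (y≤x∨y i j)) (≤⇒≼ ≤-refl))))
      (≤⇒≼ (reflexive (sym (∨-distribˡ-∧ (i ∨ j) x y))))

    module _ (a b : Carrier) where

      record SeparatingIdeal : Set (suc κ ⊔ r) where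
        field
          Mem   : Pred Carrier κ
          down  : ∀ {x y} → x ≼ y → y ∈ Mem → x ∈ Mem
          join  : ∀ {x y} → x ∈ Mem → y ∈ Mem → (x ∨ y) ∈ Mem
          b-mem : b ∈ Mem
          a-non : a ∉ Mem
      open SeparatingIdeal

      separatingIdeals : Poset (suc κ ⊔ r) κ κ
      separatingIdeals = record
        { Carrier = SeparatingIdeal
        ; _≈_ = λ I J → Mem I ≐ Mem J
        ; _≤_ = λ I J → Mem I ⊆ Mem J
        ; isPartialOrder = record
          { isPreorder = record
            { isEquivalence = record
              { refl  = id , id
              ; sym   = λ { (f , g) → g , f }
              ; trans = λ { (f , g) (f′ , g′) → (λ x → f′ (f x)) , (λ x → g (g′ x)) }
              }
            ; reflexive = proj₁
            ; trans = λ f g x → g (f x)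
            }
          ; antisym = _,_
          }
        }

      module _ (a⋠b : ¬ (a ≼ b)) where

        -- The principal ideal of b is added so that the empty chain is bounded too.
        chain-union : (C : Pred SeparatingIdeal (suc κ ⊔ r)) → IsChain separatingIdeals C →
                      ∃ λ U → ∀ {I} → I ∈ C → Mem I ⊆ Mem U
        chain-union C chain = U , λ I∈C x∈I → resize (inj₂ (_ , I∈C , x∈I))
          where
          Union : Pred Carrier _
          Union x = (x ≼ b) ⊎ (∃ λ I → I ∈ C × x ∈ Mem I)

          union-join : ∀ {x y} → x ∈ Union → y ∈ Union → (x ∨ y) ∈ Union
          union-join (inj₁ x≼b) (inj₁ y≼b) = inj₁ (≼-∨-least x≼b y≼b)
          union-join (inj₁ x≼b) (inj₂ (I , I∈C , y∈I)) =
            inj₂ (I , I∈C , join I (down I x≼b (b-mem I)) y∈I)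
          union-join (inj₂ (I , I∈C , x∈I)) (inj₁ y≼b) =
            inj₂ (I , I∈C , join I x∈I (down I y≼b (b-mem I)))
          union-join (inj₂ (I , I∈C , x∈I)) (inj₂ (J , J∈C , y∈J)) with chain I∈C J∈C
          ... | inj₁ I⊆J = inj₂ (J , J∈C , join J (I⊆J x∈I) y∈J)
          ... | inj₂ J⊆I = inj₂ (I , I∈C , join I x∈I (J⊆I y∈J))

          U : SeparatingIdeal
          U = record
            { Mem   = Resize ∘ Union
            ; down  = λ x≼y y∈ → resize (Sum.map (≼-trans x≼y)
                (λ { (I , I∈C , y∈I) → I , I∈C , down I x≼y y∈I }) (unresize y∈))
            ; join  = λ x∈ y∈ → resize (union-join (unresize x∈) (unresize y∈))
            ; b-mem = resize (inj₁ (≤⇒≼ ≤-refl))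
            ; a-non = λ a∈ → Sum.[ a⋠b , (λ { (I , _ , a∈I) → a-non I a∈I }) ] (unresize a∈)
            }

        module _ (M : SeparatingIdeal) (M-maximal : ∀ {I} → Mem M ⊆ Mem I → Mem I ⊆ Mem M) where

          -- Otherwise the ideal generated by `M` and `x` would still separate, against maximality.
          extension-hits-a : ∀ {x} → x ∉ Mem M → ∃ λ i → i ∈ Mem M × a ≼ (i ∨ x)
          extension-hits-a {x} x∉M = by-contradiction λ missed → x∉M (M-maximal {record
            { Mem   = λ y → Resize (y ∈ Extension)
            ; down  = λ y≼z z∈ → resize (ext-down y≼z (unresize z∈))
            ; join  = λ y∈ z∈ → resize (ext-join (unresize y∈) (unresize z∈))
            ; b-mem = resize (ext-base (b-mem M))
            ; a-non = missed ∘ unresize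
            }} (λ m → resize (ext-base m)) (resize (b , b-mem M , ≤⇒≼ (y≤x∨y b x))))
            where
            Extension : Pred Carrier _
            Extension y = ∃ λ i → i ∈ Mem M × y ≼ (i ∨ x)

            ext-base : ∀ {y} → y ∈ Mem M → y ∈ Extension
            ext-base {y} y∈M = y , y∈M , ≤⇒≼ (x≤x∨y y x)

            ext-down : ∀ {y z} → y ≼ z → z ∈ Extension → y ∈ Extension
            ext-down y≼z (i , i∈M , z≼) = i , i∈M , ≼-trans y≼z z≼

            ext-join : ∀ {y z} → y ∈ Extension → z ∈ Extension → (y ∨ z) ∈ Extension
            ext-join (i , i∈M , y≼) (j , j∈M , z≼) = i ∨ j , join M i∈M j∈M ,
              ≼-∨-least (≼-trans y≼ (≼-∨-mono (≤⇒≼ (x≤x∨y i j)) (≤⇒≼ ≤-refl)))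
                        (≼-trans z≼ (≼-∨-mono (≤⇒≼ (y≤x∨y i j)) (≤⇒≼ ≤-refl)))

          -- If neither factor lay in `M`, both enlarged ideals would reach `a`, and distributivity
          -- would place `a` in `M`.
          maximal⇒prime : ∀ {x y} → (x ∧ y) ∈ Mem M → x ∈ Mem M ⊎ y ∈ Mem M
          maximal⇒prime {x} {y} xy∈M with em {P = x ∈ Mem M} | em {P = y ∈ Mem M}
          ... | yes x∈M | _       = inj₁ x∈M
          ... | no _    | yes y∈M = inj₂ y∈M
          ... | no x∉M  | no y∉M  with extension-hits-a x∉M | extension-hits-a y∉M
          ...   | i , i∈M , a≼ix | j , j∈M , a≼jy = contradiction
            (down M (≼-∨-∧-least a≼ix a≼jy) (join M (join M i∈M j∈M) xy∈M)) (a-non M)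

        -- The prime ideal theorem relative to `≼`: Zorn's lemma supplies a maximal separating
        -- ideal, which is prime. Different choices of `≼` impose different constraints on the ideal
        -- found.
        prime-separation : ∃ λ (I : PrimeIdeal L) →
          (∀ {x y} → x ≼ y → y ∈ Member I → x ∈ Member I) × b ∈ Member I × a ∉ Member I
        prime-separation with zorn separatingIdeals chain-union
        ... | M , M-maximal = record
          { Member   = Mem M
          ; 0#-mem   = down M (≤⇒≼ (0#-minimum b)) (b-mem M)
          ; ∨-mem    = join M
          ; downward = down M ∘ ≤⇒≼
          ; proper   = a-non M ∘ down M (≤⇒≼ (1#-maximum a))
          ; prime    = maximal⇒prime M (λ {I} → M-maximal {I})
          } , down M , b-mem M , a-non M

  prime-≤ : ∀ {x y} → (∀ (I : PrimeIdeal L) → y ∈ Member I → x ∈ Member I) → x ≤ y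
  prime-≤ {x} {y} y∈⇒x∈ = by-contradiction λ x≰y →
    let I , _ , y∈I , x∉I = prime-separation ≤-compatible x y x≰y in x∉I (y∈⇒x∈ I y∈I)

  -- Nontriviality gives a point of `P`, from which every order component is shown to be inhabited.
  point : NonTrivial L → PrimeIdeal L
  point 0≉1 = proj₁ (prime-separation ≤-compatible 1# 0# λ 1≤0 →
    0≉1 (antisym (0#-minimum 1#) 1≤0))

  -- The identities of M₁ on prime ideals

  ∧-monoˡ : ∀ {x y} z → x ≤ y → x ∧ z ≤ y ∧ z
  ∧-monoˡ {x} z x≤y = ∧-greatest (≤-trans (x∧y≤x x z) x≤y) (x∧y≤y x z)

  -- Modulo a prime filter: the ideal found for this preorder lies inside I.
  below-compatible : ∀ (I : PrimeIdeal L) →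
                     CompatiblePreorder λ x y → ∃ λ f → f ∉ Member I × f ∧ x ≤ y
  below-compatible I = record
    { ≤⇒≼ = λ x≤y → 1# , proper I , ≤-trans (x∧y≤y 1# _) x≤y
    ; ≼-trans = λ { (f , f∉I , fx≤y) (g , g∉I , gy≤z) → f ∧ g , Sum.[ f∉I , g∉I ] ∘ prime I ,
        ≤-trans (∧-greatest (≤-trans (x∧y≤x _ _) (x∧y≤y f g))
                            (≤-trans (∧-monoˡ _ (x∧y≤x f g)) fx≤y)) gy≤z }
    ; ≼-∧-greatest = λ { (f , f∉I , fx≤y) (g , g∉I , gx≤z) → f ∧ g , Sum.[ f∉I , g∉I ] ∘ prime I ,
        ∧-greatest (≤-trans (∧-monoˡ _ (x∧y≤x f g)) fx≤y) (≤-trans (∧-monoˡ _ (x∧y≤y f g)) gx≤z) }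
    ; ≼-∨-least = λ { (f , f∉I , fx≤z) (g , g∉I , gy≤z) → f ∧ g , Sum.[ f∉I , g∉I ] ∘ prime I ,
        ≤-trans (reflexive (∧-distribˡ-∨ (f ∧ g) _ _))
          (∨-least (≤-trans (∧-monoˡ _ (x∧y≤x f g)) fx≤z)
                   (≤-trans (∧-monoˡ _ (x∧y≤y f g)) gy≤z)) }
    }

  -- Modulo the ideal `I`: a prime ideal closed under this preorder contains `I`.
  above-compatible : ∀ (I : PrimeIdeal L) →
                     CompatiblePreorder λ x y → ∃ λ i → i ∈ Member I × x ≤ i ∨ y
  above-compatible I = record
    { ≤⇒≼ = λ x≤y → 0# , 0#-mem I , ≤-trans x≤y (y≤x∨y 0# _)
    ; ≼-trans = λ { (i , i∈I , x≤iy) (j , j∈I , y≤jz) → i ∨ j , ∨-mem I i∈I j∈I ,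
        ≤-trans x≤iy (∨-least (≤-trans (x≤x∨y i j) (x≤x∨y _ _))
                              (≤-trans y≤jz (∨-monoˡ _ (y≤x∨y i j)))) }
    ; ≼-∧-greatest = λ { (i , i∈I , x≤iy) (j , j∈I , x≤jz) → i ∨ j , ∨-mem I i∈I j∈I ,
        ≼-∨-∧-least ≤-compatible x≤iy x≤jz }
    ; ≼-∨-least = λ { (i , i∈I , x≤iz) (j , j∈I , y≤jz) → i ∨ j , ∨-mem I i∈I j∈I ,
        ∨-least (≤-trans x≤iz (∨-monoˡ _ (x≤x∨y i j))) (≤-trans y≤jz (∨-monoˡ _ (y≤x∨y i j))) }
    }
    where
    ∨-monoˡ : ∀ {x y} z → x ≤ y → x ∨ z ≤ y ∨ z
    ∨-monoˡ z x≤y = ≼-∨-mono ≤-compatible x≤y ≤-refl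

  ≈-mem : ∀ (I : PrimeIdeal L) {x y} → x ≈ y → x ∈ Member I → y ∈ Member I
  ≈-mem I x≈y = downward I (reflexive (sym x≈y))

  -- If separation failed, some `f ∉ I` would satisfy `f ∧ x ≤ 0#`, so `f ≤ x *` would lie in `I`.
  -- Together with `below⇒*-∈` this is the dual description of the pseudocomplement.
  *-∈⇒below : ∀ {x} (I : PrimeIdeal L) → x * ∈ Member I → ∃ λ J → J ⊑ I × x ∉ Member J
  *-∈⇒below {x} I x*∈I with prime-separation (below-compatible I) x 0# (λ { (f , f∉I , fx≤0) →
    f∉I (downward I (⇒ (pseudocomplement x f)
      (antisym (≤-trans (reflexive (∧-comm x f)) fx≤0) (0#-minimum _))) x*∈I) })
  ... | J , J-down , 0∈J , x∉J = J ,
    -- For `y ∉ I` the inequality `y ∧ 1# ≤ y` says `1# ≼ y`, so `y ∈ J` would make `J` improper.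
    (λ {y} y∈J → by-contradiction λ y∉I → proper J
      (J-down (y , y∉I , x∧y≤x y 1#) y∈J)) ,
    x∉J

  below⇒*-∈ : ∀ {x} (I J : PrimeIdeal L) → J ⊑ I → x ∉ Member J → x * ∈ Member I
  below⇒*-∈ {x} I J J⊑I x∉J =
    J⊑I (Sum.[ (λ x∈J → contradiction x∈J x∉J) , id ]
      (prime J (≈-mem J (sym (⇐ (pseudocomplement x (x *)) ≤-refl)) (0#-mem J))))

  -- Otherwise separation modulo `K` would give a prime ideal that contains both `K` and `i`.
  maximal-∨-1# : ∀ {i} (K : PrimeIdeal L) → (∀ N → K ⊑ N → N ⊑ K) → i ∉ Member K →
                 ∃ λ k → k ∈ Member K × 1# ≤ k ∨ i
  maximal-∨-1# {i} K K-maximal i∉K = by-contradiction λ none →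
    let N , N-down , i∈N , _ = prime-separation (above-compatible K) 1# i none
    in i∉K (K-maximal N (λ {k} k∈K → N-down (k , k∈K , x≤x∨y k i) i∈N) i∈N)

  ζζ⊑ : ∀ I → ζ (ζ I) ⊑ I
  ζζ⊑ I = P.reflexive {ζ (ζ I)} {I} (P.ζ-involutive I)

  ⊑ζζ : ∀ I → I ⊑ ζ (ζ I)
  ⊑ζζ I = P.reflexive {I} {ζ (ζ I)} (P.Eq.sym {ζ (ζ I)} {I} (P.ζ-involutive I))

  ζ-swap : ∀ I J → ζ I ⊑ J → ζ J ⊑ I
  ζ-swap I J ζI⊑J = P.trans {ζ J} {ζ (ζ I)} {I} (P.ζ-antitone {ζ I} {J} ζI⊑J) (ζζ⊑ I)

  -- Under `ζ`, an ideal below `I` that omits `x ′` becomes one above `ζ I` that contains `x`.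
  ′*-∈⇒above : ∀ {x} (I : PrimeIdeal L) → x ′ * ∈ Member I → ∃ λ K → ζ I ⊑ K × x ∈ Member K
  ′*-∈⇒above I x′*∈I with *-∈⇒below I x′*∈I
  ... | J , J⊑I , x′∉J = ζ J , P.ζ-antitone {J} {I} J⊑I , x′∉J

  above⇒′*-∈ : ∀ {x} (I K : PrimeIdeal L) → ζ I ⊑ K → x ∈ Member K → x ′ * ∈ Member I
  above⇒′*-∈ {x} I K ζI⊑K x∈K = below⇒*-∈ I (ζ K) (ζ-swap I K ζI⊑K)
    λ x″∉K → x″∉K (≈-mem K (sym (′-involutive x)) x∈K)

  -- x ∧ x ′ * is the element written z below.
  module _ {x : Carrier} (I : PrimeIdeal L) where
    x∈⇒z∈ : x ∈ Member I → x ∧ x ′ * ∈ Member I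
    x∈⇒z∈ = downward I (x∧y≤x x (x ′ *))

    x′*∈⇒z∈ : x ′ * ∈ Member I → x ∧ x ′ * ∈ Member I
    x′*∈⇒z∈ = downward I (x∧y≤y x (x ′ *))

  M₁Space⇒M₁ : M₁Space P → M₁ L
  M₁Space⇒M₁ P-M₁ = record
    -- A failure at `I` yields `J` below `I` with `y ∈ I` outside `J`, and `K` above `I` with
    -- `x ∈ K` outside `I`: a chain of three points.
    { identity₁ = λ x y → prime-≤ λ I yy*∈I → by-contradiction λ xx∉I →
        let J , J⊑I , y∉J = *-∈⇒below I (downward I (y≤x∨y y (y *)) yy*∈I)
            K , ζζI⊑K , x∈K = ′*-∈⇒above (ζ I)
              (λ x′*′∈I → xx∉I (downward I (x∧y≤y x (x ′ * ′)) x′*′∈I))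
            y∈I = downward I (x≤x∨y y (y *)) yy*∈I
            x∉I = λ x∈I → xx∉I (downward I (x∧y≤x x (x ′ * ′)) x∈I)
            I⊑K = P.trans {I} {ζ (ζ I)} {K} (⊑ζζ I) ζζI⊑K
        in no-3-chain {J} {I} {K} (J⊑I , λ J≋I → y∉J (proj₂ J≋I y∈I))
                                  (I⊑K , λ I≋K → x∉I (proj₂ I≋K x∈K))
    ; identity₂ = λ x → antisym (prime-≤ (identity₂-≤ x)) (prime-≤ (identity₂-≥ x))
    }
    where
    open M₁Space P-M₁

    -- The goal asks for a walk `ζ I ⊑ A`, `ζ A ⊑ B` with `z ∈ B`. Take `A = ζ I`, `B = I` if
    -- `x ∈ K`, and `A = K`, `B = N` otherwise.
    identity₂-≥ : ∀ x (I : PrimeIdeal L) →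
                  (x ∧ x ′ *) ′ * ∈ Member I → (x ∧ x ′ *) ′ * ′ * ∈ Member I
    identity₂-≥ x I z′*∈I with ′*-∈⇒above I z′*∈I
    ... | K , ζI⊑K , z∈K with prime K z∈K
    ...   | inj₁ x∈K = above⇒′*-∈ I (ζ I) id
      (above⇒′*-∈ (ζ I) I (ζζ⊑ I) (x′*∈⇒z∈ I (above⇒′*-∈ I K ζI⊑K x∈K)))
    ...   | inj₂ x′*∈K with ′*-∈⇒above K x′*∈K
    ...     | N , ζK⊑N , x∈N = above⇒′*-∈ I K ζI⊑K (above⇒′*-∈ K N ζK⊑N (x∈⇒z∈ N x∈N))

    -- The goal asks for a prime ideal above `ζ I` containing `z`. In the last case `K` and `N` both
    -- lie above `ζ M`: `fork` gives `ζ K ⊑ N` unless two of the three coincide, and each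
    -- coincidence makes `K` or `N` the required ideal.
    identity₂-≤ : ∀ x (I : PrimeIdeal L) →
                  (x ∧ x ′ *) ′ * ′ * ∈ Member I → (x ∧ x ′ *) ′ * ∈ Member I
    identity₂-≤ x I z′*′*∈I with ′*-∈⇒above I z′*′*∈I
    ... | K , ζI⊑K , z′*∈K with ′*-∈⇒above K z′*∈K
    ...   | M , ζK⊑M , z∈M with prime M z∈M
    ...     | inj₁ x∈M = above⇒′*-∈ I K ζI⊑K (x′*∈⇒z∈ K (above⇒′*-∈ K M ζK⊑M x∈M))
    ...     | inj₂ x′*∈M with ′*-∈⇒above M x′*∈M
    ...       | N , ζM⊑N , x∈N with em {P = N ≋ K} | em {P = ζ M ≋ K} | em {P = ζ M ≋ N}
    ... | yes N≋K | _ | _ = above⇒′*-∈ I K ζI⊑K (x∈⇒z∈ K (proj₁ N≋K x∈N))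
    ... | _ | yes ζM≋K | _ = above⇒′*-∈ I N
      (P.trans {ζ I} {K} {N} ζI⊑K (P.trans {K} {ζ M} {N} (proj₂ ζM≋K) ζM⊑N)) (x∈⇒z∈ N x∈N)
    ... | _ | _ | yes ζM≋N = above⇒′*-∈ I K ζI⊑K (x∈⇒z∈ K (ζ-swap K M ζK⊑M (proj₂ ζM≋N x∈N)))
    ... | no N≉K | no ζM≉K | no ζM≉N = above⇒′*-∈ I K ζI⊑K (x′*∈⇒z∈ K (above⇒′*-∈ K N
      (fork {ζ M} {K} {N} (ζ-swap K M ζK⊑M , ζM≉K) (ζM⊑N , ζM≉N) (N≉K ∘ P.Eq.sym {K} {N})) x∈N))

  ∉-separation : ∀ {I J : PrimeIdeal L} → ¬ (J ⊑ I) → ∃ λ x → x ∈ Member J × x ∉ Member I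
  ∉-separation {I} {J} J⋢I = by-contradiction λ none →
    J⋢I λ {x} x∈J → by-contradiction λ x∉I → none (x , x∈J , x∉I)

  M₁⇒M₁Space : M₁ L → M₁Space P
  M₁⇒M₁Space L-M₁ = record
    { no-3-chain = λ {J} {I} {K} → chain {J} {I} {K}
    ; fork = λ {J} {I} {K} J⊏I J⊏K I≉K → by-contradiction (forks {J} {I} {K} J⊏I J⊏K I≉K)
    }
    where
    open M₁ L-M₁

    -- With `x ∈ K` outside `I` and `y ∈ I` outside `J`, the ideal `I` contains `y ∨ y *` but
    -- neither `x` nor `x ′ * ′`, against the first identity.
    chain : ∀ {J I K} → J ⊏ I → ¬ (I ⊏ K)
    chain {J} {I} {K} (J⊑I , J≉I) (I⊑K , I≉K)
      with ∉-separation {I} {K} (λ K⊑I → I≉K (I⊑K , K⊑I))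
         | ∉-separation {J} {I} (λ I⊑J → J≉I (J⊑I , I⊑J))
    ... | x , x∈K , x∉I | y , y∈I , y∉J =
      Sum.[ x∉I , above⇒′*-∈ (ζ I) K (P.trans {ζ (ζ I)} {I} {K} (ζζ⊑ I) I⊑K) x∈K ]
        (prime I (downward I (identity₁ x y) (∨-mem I y∈I (below⇒*-∈ I J J⊑I y∉J))))

    top-maximal : ∀ {J I} → J ⊏ I → ∀ N → I ⊑ N → N ⊑ I
    top-maximal {J} {I} J⊏I N I⊑N = by-contradiction λ N⋢I →
      chain {J} {I} {N} J⊏I (I⊑N , λ I≋N → N⋢I (proj₂ I≋N))

    -- Were ζ I ⋢ K, some x ∈ K ∖ I would lie in no prime ideal above ζ I, and then
    -- z = x ∧ x ′ * would violate the second identity at the prime ideal ζ I.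
    forks : ∀ {J I K} → J ⊏ I → J ⊏ K → ¬ (I ≋ K) → ¬ ¬ (ζ I ⊑ K)
    forks {J} {I} {K} J⊏I J⊏K I≉K ζI⋢K
      with ∉-separation {K} {ζ I} ζI⋢K
         | ∉-separation {I} {K} (λ K⊑I → I≉K (top-maximal {J} {K} J⊏K I K⊑I , K⊑I))
    ... | i , i∈ζI , i∉K | j , j∈K , j∉I with maximal-∨-1# K (top-maximal {J} {K} J⊏K) i∉K
    ...   | k , k∈K , 1≤ki =
      Sum.[ x∉I , (λ x′*∈I → let N , ζI⊑N , x∈N = ′*-∈⇒above I x′*∈I in x∉above N ζI⊑N x∈N) ]
        (prime I z∈I)
      where
      -- The summand `j` keeps `x` out of `I`. The summand `k` keeps it out of every proper ideal
      -- above `ζ I`, since such an ideal contains `i` and `1# ≤ k ∨ i`.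
      x = k ∨ j
      x∈K = ∨-mem K k∈K j∈K
      x∉I : x ∉ Member I
      x∉I x∈I = j∉I (downward I (y≤x∨y k j) x∈I)
      x∉above : ∀ N → ζ I ⊑ N → x ∉ Member N
      x∉above N ζI⊑N x∈N = proper N
        (downward N 1≤ki (∨-mem N (downward N (x≤x∨y k j) x∈N) (ζI⊑N i∈ζI)))
      -- From `J ⊑ K` and `x ∈ K` follows `z ∈ ζ J`, where `ζ I ⊑ ζ J`. This gives the doubly
      -- iterated side of the second identity, which is traded for the single one.
      z′*∈ζI : (x ∧ x ′ *) ′ * ∈ Member (ζ I)
      z′*∈ζI = ≈-mem (ζ I) (sym (identity₂ x)) (above⇒′*-∈ (ζ I) I (ζζ⊑ I)
        (above⇒′*-∈ I (ζ J) (P.ζ-antitone {J} {I} (proj₁ J⊏I))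
          (x′*∈⇒z∈ (ζ J) (above⇒′*-∈ (ζ J) K (P.trans {ζ (ζ J)} {J} {K} (ζζ⊑ J) (proj₁ J⊏K)) x∈K))))
      z∈I : x ∧ x ′ * ∈ Member I
      z∈I with ′*-∈⇒above (ζ I) z′*∈ζI
      ... | N , ζζI⊑N , z∈N =
        top-maximal {J} {I} J⊏I N (P.trans {I} {ζ (ζ I)} {N} (⊑ζζ I) ζζI⊑N) z∈N

  -- The topology of the dual space

  Basic : Carrier → Carrier → Pred (PrimeIdeal L) κ
  Basic a b I = a ∉ Member I × b ∈ Member I

  Basic-∩ : ∀ {a b a′ b′} I → Basic a b I → Basic a′ b′ I → Basic (a ∧ a′) (b ∨ b′) I
  Basic-∩ I (a∉I , b∈I) (a′∉I , b′∈I) = Sum.[ a∉I , a′∉I ] ∘ prime I , ∨-mem I b∈I b′∈I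

  Basic-∩⁻ : ∀ {a b a′ b′} I → Basic (a ∧ a′) (b ∨ b′) I → Basic a b I × Basic a′ b′ I
  Basic-∩⁻ I (aa′∉I , bb′∈I) =
    (aa′∉I ∘ downward I (x∧y≤x _ _) , downward I (x≤x∨y _ _) bb′∈I)
    , (aa′∉I ∘ downward I (x∧y≤y _ _) , downward I (y≤x∨y _ _) bb′∈I)

  Basic-ζ : ∀ {a b} I → Basic a b I → Basic (b ′) (a ′) (ζ I)
  Basic-ζ I (a∉I , b∈I) =
    (λ b″∉I → b″∉I (≈-mem I (sym (′-involutive _)) b∈I)) , a∉I ∘ ≈-mem I (′-involutive _)

  Basic-ζ⁻ : ∀ {a b} I → Basic (b ′) (a ′) (ζ I) → Basic a b I
  Basic-ζ⁻ I (b″∈I , a″∉I) =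
    a″∉I ∘ ≈-mem I (sym (′-involutive _)) , ≈-mem I (′-involutive _) (by-contradiction b″∈I)

  ζ-Basic : ∀ {a b} I → Basic a b (ζ I) → Basic (b ′) (a ′) I
  ζ-Basic I (a∉ζI , b∈ζI) = b∈ζI , by-contradiction a∉ζI

  ζ-Basic⁻ : ∀ {a b} I → Basic (b ′) (a ′) I → Basic a b (ζ I)
  ζ-Basic⁻ I (b′∉I , a′∈I) = (λ a′∉I → a′∉I a′∈I) , b′∉I

  -- Openness in the topology induced along f, expressed by basic neighbourhoods.
  InducedOpen : ∀ {a p} {A : Set a} → (A → PrimeIdeal L) → Pred A p → Set (κ ⊔ a ⊔ p)
  InducedOpen f V = ∀ x → x ∈ V → ∃₂ λ a b → Basic a b (f x) × (∀ y → Basic a b (f y) → y ∈ V)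

  module _ {a} {A : Set a} (f : A → PrimeIdeal L) where

    omits-open : ∀ x → InducedOpen f (λ i → x ∉ Member (f i))
    omits-open x i x∉ = x , 0# , (x∉ , 0#-mem (f i)) , λ _ → proj₁

    contains-open : ∀ x → InducedOpen f (λ i → x ∈ Member (f i))
    contains-open x i x∈ = 1# , x , (proper (f i) , x∈) , λ _ → proj₂

    const-open : ∀ {p} (B : Set p) → InducedOpen f (λ _ → B)
    const-open B i b = 1# , 0# , (proper (f i) , 0#-mem (f i)) , λ _ _ → b

    InducedOpen-∩ : ∀ {p q} {V : Pred A p} {W : Pred A q} →
                    InducedOpen f V → InducedOpen f W → InducedOpen f (V ∩ W)
    InducedOpen-∩ V-open W-open i (i∈V , i∈W) with V-open i i∈V | W-open i i∈W
    ... | a , b , fi∈ , ⊆V | a′ , b′ , fi∈′ , ⊆W =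
      a ∧ a′ , b ∨ b′ , Basic-∩ (f i) fi∈ fi∈′ ,
      λ j fj∈ → let fj∈ab , fj∈a′b′ = Basic-∩⁻ (f j) fj∈ in ⊆V j fj∈ab , ⊆W j fj∈a′b′

    InducedOpen-∪ : ∀ {p q} {V : Pred A p} {W : Pred A q} →
                    InducedOpen f V → InducedOpen f W → InducedOpen f (V ∪ W)
    InducedOpen-∪ V-open W-open i (inj₁ i∈V) with V-open i i∈V
    ... | a , b , fi∈ , ⊆V = a , b , fi∈ , λ j fj∈ → inj₁ (⊆V j fj∈)
    InducedOpen-∪ V-open W-open i (inj₂ i∈W) with W-open i i∈W
    ... | a , b , fi∈ , ⊆W = a , b , fi∈ , λ j fj∈ → inj₂ (⊆W j fj∈)

    InducedOpen-⋃ : ∀ {p q} {J : Set q} {V : J → Pred A p} →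
                    (∀ j → InducedOpen f (V j)) → InducedOpen f (⋃ J V)
    InducedOpen-⋃ V-open i (j , i∈V) with V-open j i i∈V
    ... | a , b , fi∈ , ⊆V = a , b , fi∈ , λ i′ fi′∈ → j , ⊆V i′ fi′∈

    InducedOpen-resp : ∀ {p q} {V : Pred A p} {W : Pred A q} →
                       V ≐ W → InducedOpen f V → InducedOpen f W
    InducedOpen-resp (V⊆W , W⊆V) V-open i i∈W with V-open i (W⊆V i∈W)
    ... | a , b , fi∈ , ⊆V = a , b , fi∈ , λ j fj∈ → V⊆W (⊆V j fj∈)

    InducedOpen-respects : ∀ {p} {V : Pred A p} → InducedOpen f V →
                           V Respects (λ i j → f i ≋ f j)
    InducedOpen-respects V-open {i} {j} (fi⊑fj , fj⊑fi) i∈V with V-open i i∈V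
    ... | a , b , (a∉ , b∈) , ⊆V = ⊆V j (a∉ ∘ fj⊑fi , fi⊑fj b∈)

  generated⇒induced : ∀ {V : Pred (PrimeIdeal L) (suc κ)} →
                      Generated (Subbasic em L) V → InducedOpen id V
  generated⇒induced (subbasic (omits a (V⊆ , ⊆V))) =
    InducedOpen-resp id ((λ {I} → ⊆V {I}) , (λ {I} → V⊆ {I})) (omits-open id a)
  generated⇒induced (subbasic (contains a (V⊆ , ⊆V))) =
    InducedOpen-resp id ((λ {I} → ⊆V {I}) , (λ {I} → V⊆ {I})) (contains-open id a)
  generated⇒induced (resp (V⊆W , W⊆V) V-gen) =
    InducedOpen-resp id ((λ {I} → V⊆W {I}) , (λ {I} → W⊆V {I})) (generated⇒induced V-gen)
  generated⇒induced total = const-open id _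
  generated⇒induced (inter V-gen W-gen) =
    InducedOpen-∩ id (generated⇒induced V-gen) (generated⇒induced W-gen)
  generated⇒induced (union V V-gen) = InducedOpen-⋃ id (λ j → generated⇒induced (V-gen j))

  induced⇒generated : ∀ {V : Pred (PrimeIdeal L) (suc κ)} →
                      InducedOpen id V → Generated (Subbasic em L) V
  induced⇒generated {V} V-open = resp
    ((λ { {I} ((a , b , ab⊆V) , lift a∉I , lift b∈I) → ab⊆V I (a∉I , b∈I) })
    , (λ {I} I∈V → let a , b , (a∉I , b∈I) , ab⊆V = V-open I I∈V in
        (a , b , ab⊆V) , lift a∉I , lift b∈I))
    -- The union runs over all basic sets contained in `V`.
    (union {J = ∃₂ λ a b → ∀ I → Basic a b I → I ∈ V}
      (λ { (a , b , _) I → Lift (suc κ) (a ∉ Member I) × Lift (suc κ) (b ∈ Member I) })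
      λ { (a , b , _) → inter
        (subbasic (omits a ((λ { (lift a∉) → a∉ }) , lift)))
        (subbasic (contains b ((λ { (lift b∈) → b∈ }) , lift))) })

  module _ {A : Set (suc κ)} (f : A → PrimeIdeal L) {V : Pred A (suc κ)} where

    pullback⇒induced : (∃ λ W → Generated (Subbasic em L) W × V ≐ (W ∘ f)) → InducedOpen f V
    pullback⇒induced (W , W-open , V⊆W , W⊆V) i i∈V
      with generated⇒induced W-open (f i) (V⊆W i∈V)
    ... | a , b , fi∈ab , ab⊆V = a , b , fi∈ab , λ j fj∈ab → W⊆V (ab⊆V (f j) fj∈ab)

    induced⇒pullback : InducedOpen f V → ∃ λ W → Generated (Subbasic em L) W × V ≐ (W ∘ f)
    induced⇒pullback V-open =
      -- The witness is the union of all basic sets whose preimage under `f` lies in `V`.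
      (λ I → ∃₂ λ a b → Basic a b I × (∀ j → Basic a b (f j) → j ∈ V)) ,
      induced⇒generated (λ { I (a , b , I∈ab , ab⊆V) →
        a , b , I∈ab , λ J J∈ab → a , b , J∈ab , ab⊆V }) ,
      (λ {i} → V-open i) ,
      (λ { {i} (a , b , fi∈ab , ab⊆V) → ab⊆V i fi∈ab })

  -- Closed sets of prime ideals.

  Closed : ∀ {p} → Pred (PrimeIdeal L) p → Set (suc κ ⊔ p)
  Closed A = InducedOpen id (∁ A)

  Closed-resp : ∀ {p q} {A : Pred (PrimeIdeal L) p} {B : Pred (PrimeIdeal L) q} →
                A ≐ B → Closed A → Closed B
  Closed-resp (A⊆B , B⊆A) = InducedOpen-resp id
    ((λ {I} I∉A I∈B → I∉A (B⊆A {I} I∈B)) , (λ {I} I∉B I∈A → I∉B (A⊆B {I} I∈A)))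

  module _ {p q} {A : Pred (PrimeIdeal L) p} {B : Pred (PrimeIdeal L) q} where

    Closed-∪ : Closed A → Closed B → Closed (A ∪ B)
    Closed-∪ A-closed B-closed = InducedOpen-resp id
      ((λ { (I∉A , I∉B) → Sum.[ I∉A , I∉B ] }) , λ I∉ → I∉ ∘ inj₁ , I∉ ∘ inj₂)
      (InducedOpen-∩ id A-closed B-closed)

    Closed-∩ : Closed A → Closed B → Closed (A ∩ B)
    Closed-∩ A-closed B-closed = InducedOpen-resp id
      ( (λ I∉ (I∈A , I∈B) → Sum.[ (λ I∉A → I∉A I∈A) , (λ I∉B → I∉B I∈B) ] I∉)
      , λ {I} I∉ → by-contradiction λ neither →
          neither (inj₁ λ I∈A → neither (inj₂ λ I∈B → I∉ (I∈A , I∈B))))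
      (InducedOpen-∪ id A-closed B-closed)

  Closed-const : ∀ {p} (B : Set p) → Closed (λ _ → B)
  Closed-const B = const-open id (¬ B)

  Closed-⊒ : ∀ I → Closed (I ⊑_)
  Closed-⊒ I J I⋢J = let a , a∈I , a∉J = ∉-separation {J} {I} I⋢J in
    a , 0# , (a∉J , 0#-mem J) , λ { K (a∉K , _) I⊑K → a∉K (I⊑K a∈I) }

  Closed-⊑ : ∀ I → Closed (_⊑ I)
  Closed-⊑ I J J⋢I = let b , b∈J , b∉I = ∉-separation {I} {J} J⋢I in
    1# , b , (proper J , b∈J) , λ { K (_ , b∈K) K⊑I → b∉I (K⊑I b∈K) }

  Closed-≋ : ∀ I → Closed (_≋ I)
  Closed-≋ I = Closed-∩ {A = _⊑ I} {B = I ⊑_} (Closed-⊑ I) (Closed-⊒ I)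

  Closed-ζ : ∀ {p} {A : Pred (PrimeIdeal L) p} → Closed A → Closed (λ I → ζ I ∈ A)
  Closed-ζ A-closed I ζI∉A with A-closed (ζ I) ζI∉A
  ... | a , b , ζI∈ab , avoids =
    b ′ , a ′ , ζ-Basic I ζI∈ab , λ J J∈ → avoids (ζ J) (ζ-Basic⁻ J J∈)

  Closed-⋃ : ∀ {n p} (A : Fin n → Pred (PrimeIdeal L) p) →
             (∀ i → Closed (A i)) → Closed (λ I → ∃ λ i → I ∈ A i)
  Closed-⋃ {ℕ.zero}  A A-closed = λ I _ → 1# , 0# , (proper I , 0#-mem I) , λ { _ _ (() , _) }
  Closed-⋃ {ℕ.suc n} A A-closed = Closed-resp
    ( (λ { (inj₁ I∈A₀) → Fin.zero , I∈A₀ ; (inj₂ (i , I∈A)) → Fin.suc i , I∈A })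
    , (λ { (Fin.zero , I∈A₀) → inj₁ I∈A₀ ; (Fin.suc i , I∈A) → inj₂ (i , I∈A) }) )
    (Closed-∪ {A = A Fin.zero} {B = λ I → ∃ λ i → I ∈ A (Fin.suc i)}
      (A-closed Fin.zero) (Closed-⋃ (A ∘ Fin.suc) (A-closed ∘ Fin.suc)))

  clopen-separation : ∀ {I J} → ¬ (I ≋ J) →
    ∃ λ a → (a ∈ Member I × a ∉ Member J) ⊎ (a ∉ Member I × a ∈ Member J)
  clopen-separation {I} {J} I≉J with em {P = I ⊑ J}
  ... | no I⋢J = let a , a∈I , a∉J = ∉-separation {J} {I} I⋢J in a , inj₁ (a∈I , a∉J)
  ... | yes I⊑J = let a , a∈J , a∉I = ∉-separation {I} {J} (λ J⊑I → I≉J (I⊑J , J⊑I)) in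
    a , inj₂ (a∉I , a∈J)

  -- Stone spaces inside the dual space.

  inducedSpace : {A : Set (suc κ)} → (A → PrimeIdeal L) → Space (suc κ) κ (suc κ)
  inducedSpace {A} f = record
    { setoid = record
      { Carrier = A
      ; _≈_ = λ i j → f i ≋ f j
      ; isEquivalence = record
        { refl  = λ {i} → P.Eq.refl {f i}
        ; sym   = λ {i} {j} → P.Eq.sym {f i} {f j}
        ; trans = λ {i} {j} {k} → P.Eq.trans {f i} {f j} {f k}
        }
      }
    ; Open = λ V → Lift (suc (suc κ)) (InducedOpen f V)
    ; isTopology = record
      { respects-≈ = λ { (lift V-open) {i} {j} → InducedOpen-respects f V-open {i} {j} }
      ; respects-≐ = λ { V≐W (lift V-open) → lift (InducedOpen-resp f V≐W V-open) }
      ; whole = lift (const-open f _)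
      ; ∩-open = λ { (lift V-open) (lift W-open) → lift (InducedOpen-∩ f V-open W-open) }
      ; ⋃-open = λ V V-open → lift (InducedOpen-⋃ f λ j → Lift.lower (V-open j))
      }
    }

  module _ {A : Set (suc κ)} (f : A → PrimeIdeal L) where
    private
      Contains Omits : Carrier → Pred A (suc κ)
      Contains a i = Lift (suc κ) (a ∈ Member (f i))
      Omits a i = Lift (suc κ) (a ∉ Member (f i))

      contains-Open : ∀ a → Space.Open (inducedSpace f) (Contains a)
      contains-Open a =
        lift (InducedOpen-resp f (lift , (λ { (lift a∈) → a∈ })) (contains-open f a))

      omits-Open : ∀ a → Space.Open (inducedSpace f) (Omits a)
      omits-Open a =
        lift (InducedOpen-resp f (lift , (λ { (lift a∉) → a∉ })) (omits-open f a))

    induced-hausdorff : Hausdorff (inducedSpace f)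
    induced-hausdorff i j i≉j with clopen-separation {f i} {f j} i≉j
    ... | a , inj₁ (a∈i , a∉j) = Contains a , Omits a , contains-Open a , omits-Open a ,
      lift a∈i , lift a∉j , λ { _ (lift a∈ , lift a∉) → a∉ a∈ }
    ... | a , inj₂ (a∉i , a∈j) = Omits a , Contains a , omits-Open a , contains-Open a ,
      lift a∉i , lift a∈j , λ { _ (lift a∉ , lift a∈) → a∉ a∈ }

    induced-totallyDisconnected : TotallyDisconnected (inducedSpace f)
    induced-totallyDisconnected C C-connected {i} {j} i∈C j∈C = by-contradiction λ i≉j →
      Sum.[ (λ { (a∈i , a∉j) → split _ (i , i∈C , lift a∈i) (j , j∈C , lift a∉j) })
          , (λ { (a∉i , a∈j) → split _ (j , j∈C , lift a∈j) (i , i∈C , lift a∉i) })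
          ] (proj₂ (clopen-separation {f i} {f j} i≉j))
      where
      split : ∀ a → ∃ (C ∩ Contains a) → ¬ ∃ (C ∩ Omits a)
      split a hit miss
        with C-connected (Contains a) (Omits a) (contains-Open a) (omits-Open a) cover hit miss
        where
        cover : C ⊆ Contains a ∪ Omits a
        cover {k} _ with em {P = a ∈ Member (f k)}
        ... | yes a∈ = inj₁ (lift a∈)
        ... | no  a∉ = inj₂ (lift a∉)
      ... | _ , _ , lift a∈ , lift a∉ = a∉ a∈

  -- For a cover of the closed set A, "a ≼ b when A ∩ Basic a b is finitely covered" is a
  -- compatible preorder; an ideal separating 1 from 0 would be an uncovered point of A.
  closed⇒compact : (A : Pred (PrimeIdeal L) κ) → Closed A →
                   Compact (inducedSpace {A = ∃ A} proj₁)
  closed⇒compact A A-closed {J} V V-open V-cover = by-contradiction λ no-subcover →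
    let I , I-down , 0∈I , 1∉I = prime-separation compatible 1# 0#
          (λ { (js , js-cover) → no-subcover (js , λ x →
            js-cover x (proper (proj₁ x) , 0#-mem (proj₁ x))) })
        uncovered : ∀ a b → Basic a b I → ¬ FinitelyCovered a b
        uncovered = λ { a b (a∉I , b∈I) a≼b → a∉I (I-down a≼b b∈I) }
        I∈A : I ∈ A
        I∈A = by-contradiction λ I∉A →
          let a , b , I∈ab , avoids = A-closed I I∉A in
          -- The basic neighbourhood misses `A`, so the empty list covers its trace on `A`.
          uncovered a b I∈ab (List.[] , λ x x∈ab → contradiction (proj₂ x) (avoids (proj₁ x) x∈ab))
        j , I∈V = V-cover (I , I∈A)
        a , b , I∈ab , ab⊆V = Lift.lower (V-open j) (I , I∈A) I∈V
    in uncovered a b I∈ab (j List.∷ List.[] , λ x x∈ab → here (ab⊆V x x∈ab))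
    where
    FinitelyCovered : Rel Carrier (suc κ)
    FinitelyCovered a b =
      ∃ λ (js : List J) → ∀ x → Basic a b (proj₁ x) → Any (λ j → x ∈ V j) js

    compatible : CompatiblePreorder FinitelyCovered
    compatible = record
      { ≤⇒≼ = λ a≤b → List.[] , λ { (I , _) (a∉I , b∈I) → contradiction (downward I a≤b b∈I) a∉I }
      ; ≼-trans = λ { {y = b} (js , js-cover) (ks , ks-cover) → js List.++ ks ,
          λ { x (a∉ , c∈) → case em {P = b ∈ Member (proj₁ x)} of λ
            { (yes b∈) → ++⁺ˡ (js-cover x (a∉ , b∈))
            ; (no  b∉) → ++⁺ʳ js (ks-cover x (b∉ , c∈)) } } }
      ; ≼-∧-greatest = λ { (js , js-cover) (ks , ks-cover) → js List.++ ks ,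
          λ { x (a∉ , bc∈) → case prime (proj₁ x) bc∈ of λ
            { (inj₁ b∈) → ++⁺ˡ (js-cover x (a∉ , b∈))
            ; (inj₂ c∈) → ++⁺ʳ js (ks-cover x (a∉ , c∈)) } } }
      ; ≼-∨-least = λ { {x = a} {y = b} (js , js-cover) (ks , ks-cover) → js List.++ ks ,
          λ { x (ab∉ , c∈) → case em {P = a ∈ Member (proj₁ x)} of λ
            { (no  a∉) → ++⁺ˡ (js-cover x (a∉ , c∈))
            ; (yes a∈) → ++⁺ʳ js (ks-cover x ((λ b∈ → ab∉ (∨-mem (proj₁ x) a∈ b∈)) , c∈)) } } }
      }

  closedStone : (A : Pred (PrimeIdeal L) κ) → Closed A → StoneSpace (suc κ) κ (suc κ)
  closedStone A A-closed = record
    { space               = inducedSpace {A = ∃ A} proj₁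
    ; compact             = closed⇒compact A A-closed
    ; hausdorff           = induced-hausdorff proj₁
    ; totallyDisconnected = induced-totallyDisconnected proj₁
    }

  -- Order components

  -- A criterion for `Q ∪ ζ(Q)` to be a double: `e` parametrizes one half, its `ζ`-image is the
  -- other, and closedness of the first half makes both clopen in the union.
  module Recognition (Q : OrderComponent P) {t te r} (T : Space t te (suc κ))
    (R : Rel (Space.Carrier T) r) (R-sym : Symmetric R) (R-resp : R Respects₂ Space._≈_ T)
    (e : Space.Carrier T → PrimeIdeal L)
    (e-cong : ∀ {s t} → Space._≈_ T s t → e s ≋ e t)
    (e-antichain : ∀ s t → e s ⊑ e t → Space._≈_ T s t)
    (e-disjoint : ∀ s t → ¬ (ζ (e s) ⊑ e t))
    (e-cross : ∀ s t → (e s ⊑ ζ (e t)) ⇔ R s t)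
    (e-closure : ∀ t → e t ∈ OrderComponent.Member Q ⊎ e t ∈ ζ-image P Q)
    (e-cover : ∀ {I} → I ∈ OrderComponent.Member Q ⊎ I ∈ ζ-image P Q →
               (∃ λ t → I ≋ e t) ⊎ (∃ λ t → I ≋ ζ (e t)))
    (e-closed : Closed (λ I → ∃ λ t → I ≋ e t))
    (e-open : ∀ {V} → Space.Open T V ⇔ InducedOpen e V)
    where

    private
      module T = Space T
      module X = InvSpace (ζ-closure P Q)
      module D = InvSpace (double T R R-sym R-resp)

    from : D.Carrier → X.Carrier
    from (inj₁ t) = e t , e-closure t
    from (inj₂ t) = X.ζ (e t , e-closure t)

    to : X.Carrier → D.Carrier
    to (I , I∈X) = Sum.map proj₁ proj₁ (e-cover I∈X)

    from∘to : ∀ x → from (to x) X.≈ x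
    from∘to (I , I∈X) with e-cover I∈X
    ... | inj₁ (t , I≋et) = P.Eq.sym {I} {e t} I≋et
    ... | inj₂ (t , I≋ζet) = P.Eq.sym {I} {ζ (e t)} I≋ζet

    from-order : ∀ u v → (u D.≤ v) ⇔ (from u X.≤ from v)
    from-order (inj₁ s) (inj₁ t) = mk⇔
      (λ { (lower s≈t) → proj₁ (e-cong s≈t) })
      (λ (es⊑et : e s ⊑ e t) → lower (e-antichain s t es⊑et))
    from-order (inj₁ s) (inj₂ t) = mk⇔
      (λ { (cross Rst) → ⇐ (e-cross s t) Rst })
      (λ (es⊑ζet : e s ⊑ ζ (e t)) → cross (⇒ (e-cross s t) es⊑ζet))
    from-order (inj₂ s) (inj₁ t) = mk⇔
      (λ ())
      (λ (ζes⊑et : ζ (e s) ⊑ e t) → ⊥-elim (e-disjoint s t ζes⊑et))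
    from-order (inj₂ s) (inj₂ t) = mk⇔
      (λ { (upper s≈t) → P.ζ-antitone {e t} {e s} (proj₂ (e-cong s≈t)) })
      (λ (ζes⊑ζet : ζ (e s) ⊑ ζ (e t)) →
        upper (T.sym (e-antichain t s (InvOrder.ζ-≤-reflect P {e s} {e t} ζes⊑ζet))))

    from-ζ : ∀ u → from (D.ζ u) X.≈ X.ζ (from u)
    from-ζ (inj₁ t) = P.Eq.refl {ζ (e t)}
    from-ζ (inj₂ t) = InvOrder.≈-ζζ P (e t)

    from-continuous : ∀ V → X.Open V → D.Open (V ∘ from)
    from-continuous V V-open =
      ⇐ e-open (λ t t∈V → let a , b , et∈ab , ab⊆V = V-nbhd (from (inj₁ t)) t∈V in
        a , b , et∈ab , λ s → ab⊆V (from (inj₁ s)))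
      , ⇐ e-open (λ t t∈V → let a , b , ζet∈ab , ab⊆V = V-nbhd (from (inj₂ t)) t∈V in
        b ′ , a ′ , ζ-Basic (e t) ζet∈ab , λ s s∈ → ab⊆V (from (inj₂ s)) (ζ-Basic⁻ (e s) s∈))
      where
      V-nbhd : InducedOpen proj₁ V
      V-nbhd = pullback⇒induced proj₁ V-open

    to-continuous : ∀ V → D.Open V → X.Open (V ∘ to)
    to-continuous V (V₁-open , V₂-open) = induced⇒pullback proj₁ nbhd
      where
      Basic-resp : ∀ {a b I J} → I ≋ J → Basic a b I → Basic a b J
      Basic-resp (I⊑J , J⊑I) (a∉I , b∈I) = a∉I ∘ J⊑I , I⊑J b∈I

      ζ-transpose : ∀ {I J} → I ≋ ζ J → ζ I ≋ J
      ζ-transpose {I} {J} I≋ζJ =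
        P.Eq.trans {ζ I} {ζ (ζ J)} {J} (P.ζ-cong {I} {ζ J} I≋ζJ) (P.ζ-involutive J)

      e≉ζe : ∀ {I s t} → I ≋ e s → ¬ (I ≋ ζ (e t))
      e≉ζe {I} {s} {t} I≋es I≋ζet = e-disjoint t s
        (P.trans {ζ (e t)} {I} {e s} (proj₂ I≋ζet) (proj₁ I≋es))

      nbhd : InducedOpen proj₁ (V ∘ to)
      nbhd (I , I∈X) I∈V with e-cover I∈X
      -- The second neighbourhood keeps away from the `ζ`-half, which is closed because `ζ` is
      -- continuous.
      ... | inj₁ (t , I≋et)
        with ⇒ e-open V₁-open t I∈V
           | Closed-ζ e-closed I (λ { (s , ζI≋es) → e≉ζe {I} {t} {s} I≋et
               (P.Eq.sym {ζ (e s)} {I} (ζ-transpose {e s} {I} (P.Eq.sym {ζ I} {e s} ζI≋es))) })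
      ...   | a , b , et∈ab , ab⊆V | a′ , b′ , I∈a′b′ , avoids =
        a ∧ a′ , b ∨ b′ ,
        Basic-∩ I (Basic-resp {I = e t} {J = I} (P.Eq.sym {I} {e t} I≋et) et∈ab) I∈a′b′ ,
        λ { (J , J∈X) J∈ → inside J J∈X (Basic-∩⁻ J J∈) }
        where
        inside : ∀ J J∈X → Basic a b J × Basic a′ b′ J → to (J , J∈X) ∈ V
        inside J J∈X (J∈ab , J∈a′b′) with e-cover J∈X
        ... | inj₁ (s , J≋es)  = ab⊆V s (Basic-resp {I = J} {J = e s} J≋es J∈ab)
        ... | inj₂ (s , J≋ζes) = ⊥-elim (avoids J J∈a′b′ (s , ζ-transpose {J} {e s} J≋ζes))
      nbhd (I , I∈X) I∈V | inj₂ (t , I≋ζet)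
        with ⇒ e-open V₂-open t I∈V
           | e-closed I (λ { (s , I≋es) → e≉ζe {I} {s} {t} I≋es I≋ζet })
      ...   | a , b , (a∉et , b∈et) , ab⊆V | a′ , b′ , I∈a′b′ , avoids =
        b ′ ∧ a′ , a ′ ∨ b′ ,
        Basic-∩ I (Basic-resp {I = ζ (e t)} {J = I} (P.Eq.sym {I} {ζ (e t)} I≋ζet)
          (Basic-ζ (e t) (a∉et , b∈et))) I∈a′b′ ,
        λ { (J , J∈X) J∈ → inside J J∈X (Basic-∩⁻ J J∈) }
        where
        inside : ∀ J J∈X → Basic (b ′) (a ′) J × Basic a′ b′ J → to (J , J∈X) ∈ V
        inside J J∈X (J∈ba , J∈a′b′) with e-cover J∈X
        ... | inj₁ J∈S = ⊥-elim (avoids J J∈a′b′ J∈S)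
        ... | inj₂ (s , J≋ζes) =
          ab⊆V s (Basic-ζ⁻ (e s) (Basic-resp {I = J} {J = ζ (e s)} J≋ζes J∈ba))

    ζ-closure≅double : ζ-closure P Q ≅ double T R R-sym R-resp
    ζ-closure≅double =
      embedding⇒≅ to from from∘to from-order from-ζ to-continuous from-continuous

  ⇔-true : ∀ {a b} (A : Set a) {B : Set b} → A → B → A ⇔ B
  ⇔-true A x y = mk⇔ (const y) (const x)

  ⇔-false : ∀ {a b} (A : Set a) {B : Set b} → ¬ A → ¬ B → A ⇔ B
  ⇔-false A ¬x ¬y = mk⇔ (⊥-elim ∘ ¬x) (⊥-elim ∘ ¬y)

  module FiniteRecognition (Q : OrderComponent P) {n} (R : Rel (Fin n) 0ℓ) (R-sym : Symmetric R)
    (e : Fin n → PrimeIdeal L)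
    (e-antichain : ∀ i j → e i ⊑ e j → i ≡ j)
    (e-disjoint : ∀ i j → ¬ (ζ (e i) ⊑ e j))
    (e-cross : ∀ i j → (e i ⊑ ζ (e j)) ⇔ R i j)
    (e-closure : ∀ i → e i ∈ OrderComponent.Member Q ⊎ e i ∈ ζ-image P Q)
    (e-cover : ∀ {I} → I ∈ OrderComponent.Member Q ⊎ I ∈ ζ-image P Q →
               (∃ λ i → I ≋ e i) ⊎ (∃ λ i → I ≋ ζ (e i)))
    where

    -- The points `e j` with `j` other than `i` form a finite, hence closed, set, so `e i` has a
    -- neighbourhood free of them.
    all-open : ∀ {p} (V : Pred (Fin n) p) → InducedOpen e V
    all-open V i i∈V with others-closed (e i)
      (λ { (j , j≢i , ei≋ej) → j≢i (≡-sym (e-antichain i j (proj₁ ei≋ej))) })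
      where
      others-closed : Closed (λ I → ∃ λ j → (¬ (j ≡ i)) × I ≋ e j)
      others-closed = Closed-⋃ (λ j I → (¬ (j ≡ i)) × I ≋ e j) λ j →
        Closed-∩ {A = λ _ → ¬ (j ≡ i)} {B = _≋ e j} (Closed-const _) (Closed-≋ (e j))
    ... | a , b , ei∈ab , avoids = a , b , ei∈ab , λ j ej∈ab → by-contradiction λ j∉V →
      avoids (e j) ej∈ab (j , (λ { ≡-refl → j∉V i∈V }) , P.Eq.refl {e j})

    ζ-closure≅finiteDouble : ζ-closure P Q ≅ finiteDouble (suc κ) R R-sym
    ζ-closure≅finiteDouble = Recognition.ζ-closure≅double Q
      (discrete (Fin n) (suc κ)) R R-sym (resp₂ R) e
      (λ { {i} ≡-refl → P.Eq.refl {e i} }) e-antichain e-disjoint e-cross e-closure e-cover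
      (Closed-⋃ (λ i → _≋ e i) (λ i → Closed-≋ (e i)))
      (λ {V} → mk⇔ (λ _ → all-open V) _)

  Listed : OrderComponent P → Set (suc (suc (suc κ)))
  Listed Q = let X = ζ-closure P Q in
      X ≅ Q₀ (suc κ)
    ⊎ X ≅ Q₁ (suc κ)
    ⊎ X ≅ Q₂ (suc κ)
    ⊎ X ≅ Q₃ (suc κ)
    ⊎ X ≅ Q₄ (suc κ)
    ⊎ X ≅ Q₅ (suc κ)
    ⊎ (∃ λ (S : StoneSpace (suc κ) κ (suc κ)) →
       HasThreePoints (StoneSpace.space S) ×
       (∃ λ (I : IsolatedSubset (StoneSpace.space S)) → X ≅ Q₆ em S I))

  -- Components with a strict comparability.

  module Nontrivial (P-M₁ : M₁Space P) (Q : OrderComponent P)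
    {x k : PrimeIdeal L} (x∈Q : x ∈ OrderComponent.Member Q) (x<k : x ⊏ k) where

    open LowerPoints em P P-M₁ Q {x} {k} x∈Q x<k

    x∈S : Lower x
    x∈S = inj₁ (P.Eq.refl {x})

    lower-cover : ∀ {a} {A : Set a} (e : A → PrimeIdeal L) →
                  (∀ {s} → Lower s → ∃ λ i → s ≋ e i) →
                  ∀ {I} → I ∈ OrderComponent.Member Q ⊎ I ∈ ζ-image P Q →
                  (∃ λ i → I ≋ e i) ⊎ (∃ λ i → I ≋ ζ (e i))
    lower-cover e e-onto {I} I∈X with closure⊆Covered {I} I∈X
    ... | inj₁ I∈S  = inj₁ (e-onto {I} I∈S)
    ... | inj₂ ζI∈S = let i , ζI≋ei = e-onto {ζ I} ζI∈S in
      inj₂ (i , P.Eq.trans {I} {ζ (ζ I)} {ζ (e i)} (InvOrder.≈-ζζ P I) (P.ζ-cong {ζ I} {e i} ζI≋ei))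

    recognize-finite : ∀ {n} (e : Fin n → PrimeIdeal L) → (∀ i → Lower (e i)) →
                       (∀ i j → e i ≋ e j → i ≡ j) →
                       (∀ {s} → Lower s → ∃ λ i → s ≋ e i) →
                       (R : Rel (Fin n) 0ℓ) (R-sym : Symmetric R) →
                       (∀ i j → (e i ⊑ ζ (e j)) ⇔ R i j) →
                       ζ-closure P Q ≅ finiteDouble (suc κ) R R-sym
    recognize-finite e e∈S e-injective e-onto R R-sym e-cross =
      FiniteRecognition.ζ-closure≅finiteDouble Q R R-sym e
        (λ i j ei⊑ej → e-injective i j (Lower-antichain {e i} {e j} (e∈S j) ei⊑ej))
        (λ i j → Lower-disjoint {e i} {e j} (e∈S i) (e∈S j))
        e-cross
        (λ i → Lower⊆closure {e i} (e∈S i))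
        (λ {I} → lower-cover e (λ {s} → e-onto {s}) {I})

    -- Distinct lower points are always adjacent, so only the two loops remain to be specified.
    recognize-pair : ∀ {u v} → Lower u → Lower v → ¬ (u ≋ v) →
                     (∀ {s} → Lower s → s ≋ u ⊎ s ≋ v) →
                     (R : Rel (Fin 2) 0ℓ) (R-sym : Symmetric R) → R 0F 1F →
                     (u ⊑ ζ u) ⇔ R 0F 0F → (v ⊑ ζ v) ⇔ R 1F 1F →
                     ζ-closure P Q ≅ finiteDouble (suc κ) R R-sym
    recognize-pair {u} {v} u∈S v∈S u≉v S⊆uv R R-sym R₀₁ R₀₀ R₁₁ =
      recognize-finite e
        (λ { 0F → u∈S ; 1F → v∈S })
        (λ { 0F 0F _ → ≡-refl ; 1F 1F _ → ≡-refl
           ; 0F 1F u≋v → contradiction u≋v u≉v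
           ; 1F 0F v≋u → contradiction (P.Eq.sym {v} {u} v≋u) u≉v })
        (λ {s} s∈S → Sum.[ (λ s≋u → 0F , s≋u) , (λ s≋v → 1F , s≋v) ]′ (S⊆uv {s} s∈S))
        R R-sym
        (λ { 0F 0F → R₀₀ ; 1F 1F → R₁₁
           ; 0F 1F → ⇔-true (u ⊑ ζ v) u⊑ζv R₀₁
           ; 1F 0F → ⇔-true (v ⊑ ζ u) (InvOrder.≤ζ-sym P {u} {v} u⊑ζv) (R-sym R₀₁) })
      where
      e : Fin 2 → PrimeIdeal L
      e 0F = u
      e 1F = v
      u⊑ζv : u ⊑ ζ v
      u⊑ζv = Lower-adjacent {u} {v} u∈S v∈S u≉v

    module _ {y} (y∈S : Lower y) (y≉x : ¬ (y ≋ x)) where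

      x≉y : ¬ (x ≋ y)
      x≉y = y≉x ∘ P.Eq.sym {x} {y}

      Lower-Closed : Closed Lower
      Lower-Closed = Closed-resp
        ( (λ {s} → closed⇒Lower {y} y∈S y≉x {s}) , (λ {s} → Lower⇒closed {y} y∈S y≉x {s}) )
        (Closed-∪ {A = λ s → x ⊑ ζ s × y ⊑ ζ s} {B = λ s → s ≋ x ⊎ s ≋ y}
          (Closed-∩ {A = λ s → x ⊑ ζ s} {B = λ s → y ⊑ ζ s}
            (Closed-ζ (Closed-⊒ x)) (Closed-ζ (Closed-⊒ y)))
          (Closed-∪ {A = _≋ x} {B = _≋ y} (Closed-≋ x) (Closed-≋ y)))

      S : StoneSpace (suc κ) κ (suc κ)
      S = closedStone Lower Lower-Closed

      -- The neighbours of s are the lower points other than s when s ⋢ ζ s, so the closed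
      -- set of neighbours then shows that s is isolated.
      loopless : IsolatedSubset (StoneSpace.space S)
      loopless = record
        { Member   = λ s → Lift (suc κ) (¬ (proj₁ s ⊑ ζ (proj₁ s)))
        ; respects = λ { {s , _} {t , _} s≋t (lift s⋢ζs) → lift λ t⊑ζt → s⋢ζs
            (P.≤-respʳ-≈ {s} {ζ t} {ζ s} (P.ζ-cong {t} {s} (P.Eq.sym {s} {t} s≋t))
              (P.≤-respˡ-≈ {ζ t} {t} {s} (P.Eq.sym {s} {t} s≋t) t⊑ζt)) }
        ; isolated = λ { {s , s∈S} (lift s⋢ζs) →
            (λ t → Lift (suc κ) (proj₁ t ≋ s)) ,
            lift (λ { (t , t∈S) (lift t≋s) →
              let a , b , s∈ab , avoids = Closed-ζ (Closed-⊒ s) s s⋢ζs in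
              a , b , ((λ a∈t → proj₁ s∈ab (proj₁ t≋s a∈t)) , proj₂ t≋s (proj₂ s∈ab)) ,
              λ { (u , u∈S) u∈ab → lift (by-contradiction λ u≉s → avoids u u∈ab
                (Lower-adjacent {s} {u} s∈S u∈S (u≉s ∘ P.Eq.sym {s} {u}))) } }) ,
            λ t → mk⇔ (λ { (lift t≋s) → t≋s }) lift }
        }

      -- Off the diagonal both sides hold by completeness of the graph; on it both say that `s` has
      -- a loop.
      R₆⇔ : ∀ s t → (proj₁ s ⊑ ζ (proj₁ t)) ⇔ R₆ em S loopless s t
      R₆⇔ (s , s∈S) (t , t∈S) = mk⇔ to from
        where
        to : s ⊑ ζ t → R₆ em S loopless (s , s∈S) (t , t∈S)
        to s⊑ζt with em {P = s ≋ t}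
        ... | no  s≉t = inj₁ s≉t
        ... | yes s≋t = inj₂ λ { (lift s⋢ζs) → s⋢ζs
          (P.≤-respʳ-≈ {s} {ζ t} {ζ s} (P.ζ-cong {t} {s} (P.Eq.sym {s} {t} s≋t)) s⊑ζt) }

        from : R₆ em S loopless (s , s∈S) (t , t∈S) → s ⊑ ζ t
        from r with em {P = s ≋ t}
        from r          | no  s≉t = Lower-adjacent {s} {t} s∈S t∈S s≉t
        from (inj₁ s≉t) | yes s≋t = contradiction s≋t s≉t
        from (inj₂ s∉I) | yes s≋t = P.≤-respʳ-≈ {s} {ζ s} {ζ t} (P.ζ-cong {s} {t} s≋t)
          (by-contradiction λ s⋢ζs → s∉I (lift s⋢ζs))

      ζ-closure≅Q₆ : ζ-closure P Q ≅ Q₆ em S loopless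
      ζ-closure≅Q₆ = Recognition.ζ-closure≅double Q (StoneSpace.space S) (R₆ em S loopless) _ _
        proj₁ id
        (λ { (s , _) (t , t∈S) → Lower-antichain {s} {t} t∈S })
        (λ { (s , s∈S) (t , t∈S) → Lower-disjoint {s} {t} s∈S t∈S })
        R₆⇔
        (λ { (s , s∈S) → Lower⊆closure {s} s∈S })
        (λ {I} → lower-cover proj₁ (λ {s} s∈S → (s , s∈S) , P.Eq.refl {s}) {I})
        (Closed-resp ((λ {s} s∈S → (s , s∈S) , P.Eq.refl {s})
                     , (λ { {s} ((t , t∈S) , s≋t) →
                         Lower-resp {t} {s} (P.Eq.sym {s} {t} s≋t) t∈S }))
          Lower-Closed)
        (mk⇔ (λ { (lift V-open) → V-open }) lift)

      pair-listed : (∀ {s} → Lower s → s ≋ x ⊎ s ≋ y) → Listed Q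
      pair-listed S⊆xy with em {P = x ⊑ ζ x} | em {P = y ⊑ ζ y}
      ... | no x⋢ζx  | no y⋢ζy  = inj₂ (inj₂ (inj₂ (inj₁ (
        recognize-pair {x} {y} x∈S y∈S x≉y (λ {s} → S⊆xy {s})
          R₃ _ xy (⇔-false (x ⊑ ζ x) x⋢ζx λ ()) (⇔-false (y ⊑ ζ y) y⋢ζy λ ())))))
      ... | no x⋢ζx  | yes y⊑ζy = inj₂ (inj₂ (inj₂ (inj₂ (inj₁ (
        recognize-pair {x} {y} x∈S y∈S x≉y (λ {s} → S⊆xy {s})
          R₄ _ xy (⇔-false (x ⊑ ζ x) x⋢ζx λ ()) (⇔-true (y ⊑ ζ y) y⊑ζy yy))))))
      -- `R₄` has its loop at the second vertex, so the two points are listed in the opposite order.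
      ... | yes x⊑ζx | no y⋢ζy  = inj₂ (inj₂ (inj₂ (inj₂ (inj₁ (
        recognize-pair {y} {x} y∈S x∈S y≉x (λ {s} → S⊆yx {s})
          R₄ _ xy (⇔-false (y ⊑ ζ y) y⋢ζy λ ()) (⇔-true (x ⊑ ζ x) x⊑ζx yy))))))
        where
        S⊆yx : ∀ {s} → Lower s → s ≋ y ⊎ s ≋ x
        S⊆yx {s} s∈S = Sum.swap (S⊆xy {s} s∈S)
      ... | yes x⊑ζx | yes y⊑ζy = inj₂ (inj₂ (inj₂ (inj₂ (inj₂ (inj₁ (
        recognize-pair {x} {y} x∈S y∈S x≉y (λ {s} → S⊆xy {s})
          R₅ _ xy (⇔-true (x ⊑ ζ x) x⊑ζx xx) (⇔-true (y ⊑ ζ y) y⊑ζy yy)))))))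

    listed : Listed Q
    listed with em {P = ∃ λ y → Lower y × ¬ (y ≋ x)}
    ... | no single = inj₂ (inj₂ (inj₁ (recognize-finite {1} (λ _ → x) (λ _ → x∈S)
      (λ { 0F 0F _ → ≡-refl }) (λ {s} s∈S → 0F , S⊆x {s} s∈S) R₂ _
      (λ { 0F 0F → ⇔-true (x ⊑ ζ x) x⊑ζx xx }))))
      where
      S⊆x : ∀ {s} → Lower s → s ≋ x
      S⊆x {s} s∈S = by-contradiction λ s≉x → single (s , s∈S , s≉x)
      -- This makes `ζ k` a lower point, hence equal to `x`; then `k` is `ζ x` and `x` has a loop.
      x<ζζk : x ⊏ ζ (ζ k)
      x<ζζk = InvOrder.<-respʳ-≈ P {x} {k} {ζ (ζ k)} (InvOrder.≈-ζζ P k) x<k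
      x⊑ζx : x ⊑ ζ x
      x⊑ζx = P.≤-respʳ-≈ {x} {ζ (ζ k)} {ζ x}
        (P.ζ-cong {ζ k} {x} (S⊆x {ζ k} (inj₂ x<ζζk))) (proj₁ x<ζζk)
    ... | yes (y , y∈S , y≉x) with em {P = ∃ λ z → Lower z × ¬ (z ≋ x) × ¬ (z ≋ y)}
    ...   | yes (z , z∈S , z≉x , z≉y) = inj₂ (inj₂ (inj₂ (inj₂ (inj₂ (inj₂
      ( S {y} y∈S y≉x
      , ((x , x∈S) , (y , y∈S) , (z , z∈S) ,
          y≉x ∘ P.Eq.sym {x} {y} , z≉x ∘ P.Eq.sym {x} {z} , z≉y ∘ P.Eq.sym {y} {z})
      , loopless {y} y∈S y≉x , ζ-closure≅Q₆ {y} y∈S y≉x ))))))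
    ...   | no  pair = pair-listed {y} y∈S y≉x λ {s} s∈S → case em {P = s ≋ x} of λ
      { (yes s≋x) → inj₁ s≋x
      ; (no  s≉x) → inj₂ (by-contradiction λ s≉y → pair (s , s∈S , s≉x , s≉y)) }

  -- Components without a strict comparability.

  module Trivial (Q : OrderComponent P) {x : PrimeIdeal L} (x∈Q : x ∈ OrderComponent.Member Q)
    (unordered : ¬ ∃₂ λ u v → u ∈ OrderComponent.Member Q × u ⊏ v) where

    comparable⇒≋ : ∀ {I J} → I ∈ OrderComponent.Member Q → Comparable P I J → J ≋ I
    comparable⇒≋ {I} {J} I∈Q (inj₁ I⊑J) = by-contradiction λ J≉I →
      unordered (I , J , I∈Q , I⊑J , J≉I ∘ P.Eq.sym {I} {J})
    comparable⇒≋ {I} {J} I∈Q (inj₂ J⊑I) = by-contradiction λ J≉I →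
      unordered (J , I , path-closed P Q I∈Q (inj₂ J⊑I ◅ ε) , J⊑I , J≉I)

    path⇒≋ : ∀ {I J} → I ∈ OrderComponent.Member Q → Path P I J → J ≋ I
    path⇒≋ {I} _ ε = P.Eq.refl {I}
    path⇒≋ {I} {J} I∈Q (_◅_ {j = K} c p) =
      P.Eq.trans {J} {K} {I} (path⇒≋ {K} {J} (path-closed P Q I∈Q (c ◅ ε)) p)
        (comparable⇒≋ {I} {K} I∈Q c)

    member⇒≋ : ∀ {I} → I ∈ OrderComponent.Member Q → I ≋ x
    member⇒≋ {I} I∈Q = path⇒≋ {x} {I} x∈Q (member-path P Q x∈Q I∈Q)

    closure⇒≋ : ∀ {I} → I ∈ OrderComponent.Member Q ⊎ I ∈ ζ-image P Q → I ≋ x ⊎ I ≋ ζ x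
    closure⇒≋ {I} (inj₁ I∈Q) = inj₁ (member⇒≋ {I} I∈Q)
    closure⇒≋ {I} (inj₂ (J , J∈Q , I≋ζJ)) =
      inj₂ (P.Eq.trans {I} {ζ J} {ζ x} I≋ζJ (P.ζ-cong {J} {x} (member⇒≋ {J} J∈Q)))

    -- The component is the single point `x`, and its `ζ`-closure has one or two points according to
    -- whether `ζ` fixes `x`.
    listed : Listed Q
    listed with em {P = x ≋ ζ x}
    ... | yes x≋ζx = inj₁ (embedding⇒≅ (λ _ → _) (λ _ → x , inj₁ x∈Q)
      (λ { (I , I∈X) → P.Eq.sym {I} {x} (X⊆x {I} I∈X) })
      (λ _ _ → mk⇔ (λ _ {a} → id) (λ _ → ≡-refl))
      (λ _ → x≋ζx)
      (λ V _ → induced⇒pullback proj₁ (const-open proj₁ (V _)))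
      _)
      where
      X⊆x : ∀ {I} → I ∈ OrderComponent.Member Q ⊎ I ∈ ζ-image P Q → I ≋ x
      X⊆x {I} I∈X = Sum.[ id , (λ I≋ζx → P.Eq.trans {I} {ζ x} {x} I≋ζx (P.Eq.sym {x} {ζ x} x≋ζx)) ]
        (closure⇒≋ {I} I∈X)
    ... | no x≉ζx = inj₂ (inj₁ (FiniteRecognition.ζ-closure≅finiteDouble Q R₁ _ (λ _ → x)
      (λ { 0F 0F _ → ≡-refl })
      (λ _ _ ζx⊑x → x≉ζx (P.Eq.sym {ζ x} {x} (comparable⇒≋ {x} {ζ x} x∈Q (inj₂ ζx⊑x))))
      (λ _ _ → ⇔-false (x ⊑ ζ x)
        (λ x⊑ζx → x≉ζx (P.Eq.sym {ζ x} {x} (comparable⇒≋ {x} {ζ x} x∈Q (inj₁ x⊑ζx)))) λ ())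
      (λ _ → inj₁ x∈Q)
      (λ {I} I∈X → Sum.map (0F ,_) (0F ,_) (closure⇒≋ {I} I∈X))))

  -- The classification and its converse.

  classification : PrimeIdeal L → M₁Space P → ∀ Q → Listed Q
  classification I₀ P-M₁ Q with inhabited P Q em I₀
  ... | x , x∈Q with em {P = ∃₂ λ u v → u ∈ OrderComponent.Member Q × u ⊏ v}
  ...   | yes (u , v , u∈Q , u⊏v) = Nontrivial.listed P-M₁ Q {u} {v} u∈Q u⊏v
  ...   | no unordered = Trivial.listed Q x∈Q unordered

  -- Apart from `Q₀`, which has no strict comparability, the listed spaces are doubles, so a check
  -- of each relation suffices; in `Q₆` distinct points are always related.
  listed⇒M₁Space : ∀ Q → Listed Q → M₁Space (ζ-closure P Q)
  listed⇒M₁Space Q = λ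
    { (inj₁ X≅Q₀) → ≅-reflects-M₁Space X≅Q₀ (record
        { no-3-chain = λ { (≡-refl , x≢x) → contradiction ≡-refl x≢x }
        ; fork = λ { (≡-refl , x≢x) → contradiction ≡-refl x≢x } })
    ; (inj₂ (inj₁ X≅Q₁)) → ≅-reflects-M₁Space X≅Q₁ (double-M₁Space _ R₁ _ _ λ ())
    ; (inj₂ (inj₂ (inj₁ X≅Q₂))) → ≅-reflects-M₁Space X≅Q₂ (double-M₁Space _ R₂ _ _ λ
        { xx xx _ → xx })
    ; (inj₂ (inj₂ (inj₂ (inj₁ X≅Q₃)))) → ≅-reflects-M₁Space X≅Q₃ (double-M₁Space _ R₃ _ _ λ
        { xy xy 1≢1 → contradiction ≡-refl 1≢1
        ; yx yx 0≢0 → contradiction ≡-refl 0≢0 })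
    ; (inj₂ (inj₂ (inj₂ (inj₂ (inj₁ X≅Q₄))))) → ≅-reflects-M₁Space X≅Q₄ (double-M₁Space _ R₄ _ _ λ
        { xy xy _ → yy
        ; yy yy _ → yy
        ; yy yx _ → yx
        ; yx yy _ → xy
        ; yx yx 0≢0 → contradiction ≡-refl 0≢0 })
    ; (inj₂ (inj₂ (inj₂ (inj₂ (inj₂ (inj₁ X≅Q₅)))))) →
      ≅-reflects-M₁Space X≅Q₅ (double-M₁Space _ R₅ _ _ λ
        { xx xx _ → xx ; xx xy _ → xy ; xy xx _ → yx ; xy xy _ → yy
        ; yx yx _ → xx ; yx yy _ → xy ; yy yx _ → yx ; yy yy _ → yy })
    ; (inj₂ (inj₂ (inj₂ (inj₂ (inj₂ (inj₂ (S , _ , I , X≅Q₆))))))) →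
        ≅-reflects-M₁Space X≅Q₆ (double-M₁Space _ (R₆ em S I) _ _ λ _ _ → inj₁)
    }

  M₁⇔Listed : NonTrivial L → M₁ L ⇔ (∀ Q → Listed Q)
  M₁⇔Listed 0≉1 = mk⇔
    (λ L-M₁ → classification (point 0≉1) (M₁⇒M₁Space L-M₁))
    (λ listed → M₁Space⇒M₁ (components⇒M₁Space P λ Q → listed⇒M₁Space Q (listed Q)))

theorem4p8 :
  (em : ∀ {a} → ExcludedMiddle a) →
  (zorn : ∀ {a ℓ₁ ℓ₂} → ZornsLemma a ℓ₁ ℓ₂) →
  ∀ {c ℓ} (L : PMAlgebra c ℓ) → NonTrivial L →
  let κ = c ⊔ ℓ
      P = dualSpace em L
  in M₁ L ⇔ (∀ (Q : OrderComponent P) →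
       let X = ζ-closure P Q in
         X ≅ Q₀ (suc κ)
       ⊎ X ≅ Q₁ (suc κ)
       ⊎ X ≅ Q₂ (suc κ)
       ⊎ X ≅ Q₃ (suc κ)
       ⊎ X ≅ Q₄ (suc κ)
       ⊎ X ≅ Q₅ (suc κ)
       ⊎ (∃ λ (S : StoneSpace (suc κ) κ (suc κ)) →
          HasThreePoints (StoneSpace.space S) ×
          (∃ λ (I : IsolatedSubset (StoneSpace.space S)) → X ≅ Q₆ em S I)))
theorem4p8 em zorn L = M₁⇔Listed
  where open PrimeIdeals em zorn L
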